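{- For each integer $n\ge 0$, let $d_n$ be the smallest positive integer such that $d_n \cdot (1^n + 2^n + \cdots + x^n)$ is a polynomial in $x$ with integer coefficients, let $q_n := d_n/(n+1)$ (an integer), and let $M_n := \frac{n+2}{2}$ if $n$ is even and $M_n := \frac{n+2}{3}$ if $n$ is odd. Then for any fixed $n \ge 0$, $$q_n = \prod_{p \le M_n} p^{\varepsilon_p},$$ the product over primes $p$, where $\varepsilon_p$ (depending on $n$) is defined as follows: $\varepsilon_2 = 0$ if $n = 2^r - 1$ for some $r \ge 0$, and $\varepsilon_2 = 1$ otherwise; and for an odd prime $p \le M_n$, $\varepsilon_p = 0$ if $p \nmid (n+2)$ and $p \mid \binom{n+1}{j(p-1)}$ for all $j = 2, 3, \ldots, \left\lfloor \frac{n}{p-1} \right\rfloor - 1$, and $\varepsilon_p = 1$ otherwise.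
   Context: Here $1^n+\cdots+x^n$ denotes the unique polynomial in $\mathbb{Q}[x]$ agreeing with this sum at all positive integers $x$. An empty product equals $1$. -}

module Defs where

open import Data.Nat using (ℕ; zero; suc; _+_; _*_; _∸_; _^_; _≤_)
open import Data.Nat.DivMod using (_/_)
open import Data.Nat.Primality using (prime?; Prime)
open import Data.Nat.Divisibility using (_∣_)
open import Data.Nat.Combinatorics using (_C_)
open import Data.Product using (_×_)
open import Relation.Nullary using (¬_)
open import Relation.Binary.PropositionalEquality using (_≢_)
open import Data.Integer using (ℤ; +_)
open import Data.Rational as Q using (ℚ)
open import Data.List using (List; []; _∷_; map)
open import Data.List.Relation.Unary.All using (All)
open import Data.Product using (∃-syntax)
open import Data.Bool using (if_then_else_)
open import Relation.Nullary using (does)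
open import Relation.Binary.PropositionalEquality using (_≡_)

ℤtoℚ : ℤ → ℚ
ℤtoℚ z = z Q./ 1

ℕtoℚ : ℕ → ℚ
ℕtoℚ m = ℤtoℚ (+ m)

IsInt : ℚ → Set
IsInt a = ∃[ z ] (a ≡ ℤtoℚ z)

-- polynomials over ℚ as coefficient lists, constant term first
Poly : Set
Poly = List ℚ

eval : Poly → ℚ → ℚ
eval [] x = Q.0ℚ
eval (a ∷ c) x = a Q.+ (x Q.* eval c x)

scale : ℚ → Poly → Poly
scale d c = map (d Q.*_) c

IntegerCoeffs : Poly → Set
IntegerCoeffs c = All IsInt c

powerSum : ℕ → ℕ → ℕ
powerSum n zero = 0
powerSum n (suc x) = powerSum n x + suc x ^ n

-- c is (a representative of) the polynomial 1^n + ... + x^n :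
-- it agrees with the sum at all positive integers x
IsPowerSumPoly : ℕ → Poly → Set
IsPowerSumPoly n c = ∀ x → 1 ≤ x → eval c (ℕtoℚ x) ≡ ℕtoℚ (powerSum n x)

IsLeastDenom : Poly → ℕ → Set
IsLeastDenom c d =
  1 ≤ d × IntegerCoeffs (scale (ℕtoℚ d) c)
  × (∀ d' → 1 ≤ d' → IntegerCoeffs (scale (ℕtoℚ d') c) → d ≤ d')

-- floor division (divisor 0 never used)
floorDiv : ℕ → ℕ → ℕ
floorDiv n zero = 0
floorDiv n (suc k) = n / suc k

floorM : ℕ → ℕ
floorM n = if does (Data.Nat._≟_ (n Data.Nat.% 2) 0) then (n + 2) / 2 else (n + 2) / 3
  where import Data.Nat

primeProd : ℕ → (ℕ → ℕ) → ℕ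
primeProd zero f = 1
primeProd (suc m) f =
  (if does (prime? (suc m)) then f (suc m) else 1) * primeProd m f

IsMersenneIndex : ℕ → Set
IsMersenneIndex n = ∃[ r ] (suc n ≡ 2 ^ r)

OddZeroCond : ℕ → ℕ → Set
OddZeroCond n p =
  ¬ (p ∣ n + 2)
  × (∀ j → 2 ≤ j → j ≤ floorDiv n (p ∸ 1) ∸ 1 → p ∣ (suc n) C (j * (p ∸ 1)))

EpsSpec : ℕ → (ℕ → ℕ) → Set
EpsSpec n ε =
  (IsMersenneIndex n → ε 2 ≡ 0)
  × (¬ IsMersenneIndex n → ε 2 ≡ 1)
  × (∀ p → Prime p → p ≢ 2 → p ≤ floorM n →
       (OddZeroCond n p → ε p ≡ 0) × (¬ OddZeroCond n p → ε p ≡ 1))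

{-# OPTIONS --safe #-}

-- Let B_k be the Bernoulli numbers with B_1 = 1/2.  By Faulhaber's formula the coefficients of the power sum polynomial
-- are C(n+1, k) B_k / (n+1) for k ≤ n, and the leading one is 1/(n+1).  Hence d_n = (n+1) q_n, where q_n is the least
-- common denominator of the numbers C(n+1, k) B_k.  The von Staudt–Clausen argument, comparing p B_k with
-- 1^k + … + p^k modulo p, shows that p B_k is p-integral, so q_n is squarefree, and that, for odd p and k > 0, p divides
-- the denominator of B_k exactly if p - 1 divides k.  So an odd prime p divides q_n if and only if some
-- C(n+1, j(p-1)) with 0 < j(p-1) ≤ n is not divisible by p.  The two extreme values of j are decided by base-p digits (Lucas' theorem):
-- for j = 1 the condition is p | n+2, and for j = ⌊n/(p-1)⌋ a unit can be moved between the digits of j(p-1), which leads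
-- to a smaller j.  If p > M_n, then neither p | n+2 nor an intermediate j is possible.  For p = 2 only k = 1 and even k
-- matter, and k may be taken to be a power of 2 below n+1, unless n+1 is itself a power of 2.
module Submission where

open import Defs
open import Algebra.Bundles using (CommutativeSemigroup)
import Algebra.Properties.CommutativeSemigroup as CommutativeSemigroupProperties
open import Algebra.Structures using (IsCommutativeSemiring; IsCommutativeRing)
open import Data.Integer as ℤ using (ℤ; -[1+_]) renaming (+_ to pos)
import Data.Integer.Properties as ℤ
open import Data.List using ([]; _∷_; length; applyUpTo)
open import Data.List.Relation.Unary.All using ([]; _∷_)
open import Data.Nat
open import Data.Nat.Combinatorics
open import Data.Nat.Coprimality as Coprimality using (Coprime)
open import Data.Nat.Divisibility
open import Data.Nat.DivMod using (m≡m%n+[m/n]*n; m%n<n; m/n*n≤m; m*n/n≡m; /-monoˡ-≤; m/n<m)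
open import Data.Nat.Induction using (<-rec; <-wellFounded)
open import Data.Nat.Primality
open import Data.Nat.Primality.Factorisation using (factorise)
open import Data.Nat.Properties
open import Data.Nat.Tactic.RingSolver using (solve-∀)
open import Data.Product using (∃-syntax; ∃₂; _×_; _,_; proj₁; proj₂)
open import Data.Rational using (ℚ; mkℚ; 0ℚ; 1ℚ; 1/_; toℚᵘ)
  renaming (≢-nonZero to ≢-nonZeroℚ; _+_ to _+ℚ_; _*_ to _*ℚ_; -_ to -ℚ_; _-_ to _-ℚ_)
import Data.Rational.Properties as ℚ
open import Algebra.Properties.Group ℚ.+-0-group using () renaming (∙-cancelˡ to +ℚ-cancelˡ)
open import Data.Rational.Solver using (module +-*-Solver)
open +-*-Solver using (solve; _:+_; _:*_; :-_; _:-_; _:=_; con)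
open import Data.Rational.Unnormalised as ℚᵘ using (mkℚᵘ; *≡*)
import Data.Rational.Unnormalised.Properties as ℚᵘ
open import Data.Sum using (_⊎_; inj₁; inj₂; [_,_]′)
open import Function using (_∘_; id; case_of_)
open import Induction.WellFounded using (Acc; acc)
open import Level using (0ℓ)
open import Relation.Binary.PropositionalEquality hiding (J)
open import Relation.Nullary using (¬_; yes; no; contradiction)
open import Relation.Nullary.Decidable using (_×-dec_; ¬?; decidable-stable)

-- Binomial coefficients modulo a prime

-- Faulhaber's formula at x = p consists of p B_k and the terms C(k,i) (p B_(k-i)) p^i/(i+1) with i
-- ≥ 1. Here p divides i + 1 fewer than i times, unless p = 2 and i = 1. This single exception is
-- why 2 is treated apart. Moving a unit from the digit of p^(e+1) to the lowest digit lowers k by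
-- p^(e+1) - 1, a multiple of p - 1, so the new index is again some j(p-1). At the last j the move
-- is possible because n+1 < k + p. If p does not divide C(n+1, k), Lucas' theorem then forces n+1
-- and k to agree in all digits above the lowest one, and k < n+1 leaves room in the lowest. Both
-- directions of the final equality come from one dichotomy for each prime, with integrality of a
-- rational number tested locally. So the denominators themselves are never computed.

[1+k]*C≡[1+n]*C : ∀ n k → suc k * (suc n C suc k) ≡ suc n * (n C k)
[1+k]*C≡[1+n]*C zero zero = refl
[1+k]*C≡[1+n]*C zero (suc k) = begin
  (2 + k) * (1 C (2 + k)) ≡⟨ cong ((2 + k) *_) (k>n⇒nCk≡0 {1} {2 + k} (s≤s (s≤s z≤n))) ⟩
  (2 + k) * 0             ≡⟨ *-zeroʳ (2 + k) ⟩
  0                       ≡⟨ cong (1 *_) (k>n⇒nCk≡0 {0} {suc k} (s≤s z≤n)) ⟨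
  1 * (0 C suc k)         ∎
  where open ≡-Reasoning
[1+k]*C≡[1+n]*C (suc n) zero = begin
  1 * ((2 + n) C 1)     ≡⟨ *-identityˡ _ ⟩
  (2 + n) C 1           ≡⟨ nC1≡n (2 + n) ⟩
  2 + n                 ≡⟨ *-identityʳ (2 + n) ⟨
  (2 + n) * (suc n C 0) ∎
  where open ≡-Reasoning
[1+k]*C≡[1+n]*C (suc n) (suc k) = begin
  (2 + k) * ((2 + n) C (2 + k))                         ≡⟨ cong ((2 + k) *_) (nCk+nC[k+1]≡[n+1]C[k+1] (suc n) (suc k)) ⟨
  (2 + k) * (suc n C suc k + suc n C (2 + k))           ≡⟨ regroup (suc k) (suc n C suc k) (suc n C (2 + k)) ⟩
  suc n C suc k + (suc k * (suc n C suc k) + (2 + k) * (suc n C (2 + k)))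
    ≡⟨ cong (suc n C suc k +_) (cong₂ _+_ ([1+k]*C≡[1+n]*C n k) ([1+k]*C≡[1+n]*C n (suc k))) ⟩
  suc n C suc k + (suc n * (n C k) + suc n * (n C suc k)) ≡⟨ cong (suc n C suc k +_) (*-distribˡ-+ (suc n) (n C k) (n C suc k)) ⟨
  suc n C suc k + suc n * (n C k + n C suc k)           ≡⟨ cong (λ t → suc n C suc k + suc n * t) (nCk+nC[k+1]≡[n+1]C[k+1] n k) ⟩
  (2 + n) * (suc n C suc k)                             ∎
  where
  open ≡-Reasoning
  regroup : ∀ a x y → suc a * (x + y) ≡ x + (a * x + suc a * y)
  regroup = solve-∀

absorption : ∀ n .{{_ : NonZero n}} k → suc k * (n C suc k) ≡ n * (pred n C k)
absorption (suc n) k = [1+k]*C≡[1+n]*C n k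

[1+n]Cn≡1+n : ∀ n → suc n C n ≡ suc n
[1+n]Cn≡1+n n = begin
  suc n C n           ≡⟨ nCk≡nC[n∸k] (n≤1+n n) ⟩
  suc n C (suc n ∸ n) ≡⟨ cong (suc n C_) (m+n∸n≡m 1 n) ⟩
  suc n C 1           ≡⟨ nC1≡n (suc n) ⟩
  suc n               ∎
  where open ≡-Reasoning

-- Congruences between natural numbers

infix 4 _≡_[mod_]
_≡_[mod_] : ℕ → ℕ → ℕ → Set
a ≡ b [mod p ] = ∃₂ λ u v → a + u * p ≡ b + v * p

module _ {p : ℕ} where

  mod-reflexive : ∀ {a b} → a ≡ b → a ≡ b [mod p ]
  mod-reflexive a≡b = 0 , 0 , cong (_+ 0) a≡b

  mod-sym : ∀ {a b} → a ≡ b [mod p ] → b ≡ a [mod p ]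
  mod-sym (u , v , eq) = v , u , sym eq

  mod-trans : ∀ {a b c} → a ≡ b [mod p ] → b ≡ c [mod p ] → a ≡ c [mod p ]
  mod-trans {a} {b} {c} (u , v , eq) (u′ , v′ , eq′) = u + u′ , v + v′ , (begin
    a + (u + u′) * p     ≡⟨ r₁ a u u′ p ⟩
    (a + u * p) + u′ * p ≡⟨ cong (_+ u′ * p) eq ⟩
    (b + v * p) + u′ * p ≡⟨ r₂ b v u′ p ⟩
    (b + u′ * p) + v * p ≡⟨ cong (_+ v * p) eq′ ⟩
    (c + v′ * p) + v * p ≡⟨ r₃ c v v′ p ⟩
    c + (v + v′) * p     ∎)
    where
    open ≡-Reasoning
    r₁ : ∀ a u u′ p → a + (u + u′) * p ≡ (a + u * p) + u′ * p
    r₁ = solve-∀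
    r₂ : ∀ b v u′ p → (b + v * p) + u′ * p ≡ (b + u′ * p) + v * p
    r₂ = solve-∀
    r₃ : ∀ c v v′ p → (c + v′ * p) + v * p ≡ c + (v + v′) * p
    r₃ = solve-∀

  mod-+ : ∀ {a b c d} → a ≡ b [mod p ] → c ≡ d [mod p ] → a + c ≡ b + d [mod p ]
  mod-+ {a} {b} {c} {d} (u , v , eq) (u′ , v′ , eq′) = u + u′ , v + v′ , (begin
    (a + c) + (u + u′) * p       ≡⟨ r a c u u′ p ⟩
    (a + u * p) + (c + u′ * p)   ≡⟨ cong₂ _+_ eq eq′ ⟩
    (b + v * p) + (d + v′ * p)   ≡⟨ r b d v v′ p ⟨
    (b + d) + (v + v′) * p       ∎)
    where
    open ≡-Reasoning
    r : ∀ a c u u′ p → (a + c) + (u + u′) * p ≡ (a + u * p) + (c + u′ * p)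
    r = solve-∀

  mod-* : ∀ {a b c d} → a ≡ b [mod p ] → c ≡ d [mod p ] → a * c ≡ b * d [mod p ]
  mod-* {a} {b} {c} {d} (u , v , eq) (u′ , v′ , eq′) =
    a * u′ + u * c + u * u′ * p , b * v′ + v * d + v * v′ * p , (begin
    a * c + (a * u′ + u * c + u * u′ * p) * p ≡⟨ r a c u u′ p ⟩
    (a + u * p) * (c + u′ * p)                ≡⟨ cong₂ _*_ eq eq′ ⟩
    (b + v * p) * (d + v′ * p)                ≡⟨ r b d v v′ p ⟨
    b * d + (b * v′ + v * d + v * v′ * p) * p ∎)
    where
    open ≡-Reasoning
    r : ∀ a c u u′ p → a * c + (a * u′ + u * c + u * u′ * p) * p ≡ (a + u * p) * (c + u′ * p)
    r = solve-∀

  mod-cancelʳ-+ : ∀ {a b} c → a + c ≡ b + c [mod p ] → a ≡ b [mod p ]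
  mod-cancelʳ-+ {a} {b} c (u , v , eq) = u , v , +-cancelʳ-≡ c _ _ (begin
    a + u * p + c   ≡⟨ r a (u * p) c ⟩
    a + c + u * p   ≡⟨ eq ⟩
    b + c + v * p   ≡⟨ r b (v * p) c ⟨
    b + v * p + c   ∎)
    where
    open ≡-Reasoning
    r : ∀ a x c → a + x + c ≡ a + c + x
    r = solve-∀

  mod-resp-∣ : ∀ {a b} → a ≡ b [mod p ] → p ∣ a → p ∣ b
  mod-resp-∣ {a} {b} (u , v , eq) p∣a =
    ∣m+n∣m⇒∣n (subst (p ∣_) (trans eq (+-comm b (v * p))) (∣m∣n⇒∣m+n p∣a (n∣m*n u))) (n∣m*n v)

  ∣⇒≡0 : ∀ {a} → p ∣ a → a ≡ 0 [mod p ]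
  ∣⇒≡0 {a} (divides q eq) = 0 , q , trans (+-identityʳ a) eq

  ≡0⇒∣ : ∀ {a} → a ≡ 0 [mod p ] → p ∣ a
  ≡0⇒∣ a≡0 = mod-resp-∣ (mod-sym a≡0) (p ∣0)

-- Lucas' theorem and its consequences

module _ {p : ℕ} (pr : Prime p) where

  private
    instance
      p≢0 : NonZero p
      p≢0 = prime⇒nonZero pr
    1<p : 1 < p
    1<p = nonTrivial⇒n>1 p {{prime⇒nonTrivial pr}}
    0<p : 0 < p
    0<p = <-trans z<s 1<p

  prime∤1 : ¬ p ∣ 1
  prime∤1 p∣1 = <⇒≱ 1<p (∣⇒≤ p∣1)

  prime∤* : ∀ {a b} → ¬ p ∣ a → ¬ p ∣ b → ¬ p ∣ a * b
  prime∤* {a} {b} p∤a p∤b p∣ab = [ p∤a , p∤b ]′ (euclidsLemma a b pr p∣ab)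

  prime∣*∤⇒∣ : ∀ a b → p ∣ a * b → ¬ p ∣ a → p ∣ b
  prime∣*∤⇒∣ a b p∣ab p∤a = [ (λ p∣a → contradiction p∣a p∤a) , id ]′ (euclidsLemma a b pr p∣ab)

  p∤1+k : ∀ {k} → suc k < p → ¬ p ∣ suc k
  p∤1+k 1+k<p p∣1+k = <⇒≱ 1+k<p (∣⇒≤ p∣1+k)

  p∣pCk : ∀ {k} → 0 < k → k < p → p ∣ p C k
  p∣pCk {suc k} _ 1+k<p = prime∣*∤⇒∣ (suc k) (p C suc k)
    (subst (p ∣_) (sym (absorption p k)) (m∣m*n (pred p C k))) (p∤1+k 1+k<p)

  -- Vandermonde's convolution with the row C p _, which is 1, 0, …, 0, 1 modulo p.
  C-row-lo : ∀ m {k} → k < p → (p + m) C k ≡ m C k [mod p ]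
  C-row-lo zero {zero} _ = mod-reflexive refl
  C-row-lo zero {suc k} k<p = mod-trans (∣⇒≡0 (subst (λ t → p ∣ t C suc k) (sym (+-identityʳ p)) (p∣pCk (s≤s z≤n) k<p)))
                                        (mod-reflexive (sym (k>n⇒nCk≡0 {0} {suc k} (s≤s z≤n))))
  C-row-lo (suc m) {zero} _ = mod-reflexive refl
  C-row-lo (suc m) {suc k} k<p =
    subst₂ (_≡_[mod p ])
      (trans (nCk+nC[k+1]≡[n+1]C[k+1] (p + m) k) (cong (_C suc k) (sym (+-suc p m))))
      (nCk+nC[k+1]≡[n+1]C[k+1] m k)
      (mod-+ (C-row-lo m (<-trans (n<1+n k) k<p)) (C-row-lo m k<p))

  C-row-hi : ∀ m k → (p + m) C (p + k) ≡ m C (p + k) + m C k [mod p ]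
  C-row-hi zero zero = mod-reflexive (trans (nCn≡1 (p + 0)) (sym (cong (_+ 1) (k>n⇒nCk≡0 {0} {p + 0} (≤-trans 0<p (m≤m+n p 0))))))
  C-row-hi zero (suc k) = mod-reflexive (trans (k>n⇒nCk≡0 (+-monoʳ-< p {0} {suc k} (s≤s z≤n)))
    (sym (cong₂ _+_ (k>n⇒nCk≡0 {0} {p + suc k} (≤-trans 0<p (m≤m+n p (suc k)))) (k>n⇒nCk≡0 {0} {suc k} (s≤s z≤n)))))
  -- For k = 0 Pascal's rule reaches into column p - 1, which belongs to `C-row-lo`.
  C-row-hi (suc m) zero = subst₂ (_≡_[mod p ])
      (trans (nCk+nC[k+1]≡[n+1]C[k+1] (p + m) (pred p)) (cong₂ _C_ (sym (+-suc p m)) p≡))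
      (trans (sym (+-assoc (m C pred p) (m C (p + 0)) 1))
        (cong (_+ 1) (trans (cong (λ t → m C pred p + m C t) (sym p≡)) (trans (nCk+nC[k+1]≡[n+1]C[k+1] m (pred p)) (cong (suc m C_) p≡)))))
      (mod-+ (C-row-lo m (≤-reflexive (suc-pred p))) (subst (λ t → (p + m) C t ≡ m C (p + 0) + m C 0 [mod p ]) (sym p≡) (C-row-hi m 0)))
    where
    p≡ : suc (pred p) ≡ p + 0
    p≡ = trans (suc-pred p) (sym (+-identityʳ p))
  C-row-hi (suc m) (suc k) = subst₂ (_≡_[mod p ])
      (trans (cong (λ t → (p + m) C (p + k) + (p + m) C t) (+-suc p k))
        (trans (nCk+nC[k+1]≡[n+1]C[k+1] (p + m) (p + k)) (cong₂ _C_ (sym (+-suc p m)) (sym (+-suc p k)))))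
      (trans (r (m C (p + k)) (m C k) (m C (p + suc k)) (m C suc k))
        (cong₂ _+_ (trans (cong (λ t → m C (p + k) + m C t) (+-suc p k))
          (trans (nCk+nC[k+1]≡[n+1]C[k+1] m (p + k)) (cong (suc m C_) (sym (+-suc p k))))) (nCk+nC[k+1]≡[n+1]C[k+1] m k)))
      (mod-+ (C-row-hi m k) (C-row-hi m (suc k)))
    where
    r : ∀ a b c d → (a + b) + (c + d) ≡ (a + c) + (b + d)
    r = solve-∀

  -- Removing one p from the upper index splits the coefficient into those for (a-1, c) and (a-1,
  -- c-1). Pascal's rule for the higher parts puts them together again. Only b and d are digits; a
  -- and c are arbitrary.
  lucas : ∀ a c {b d} → b < p → d < p → (a * p + b) C (c * p + d) ≡ (a C c) * (b C d) [mod p ]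
  lucas zero zero {b} {d} b<p d<p = mod-reflexive (sym (+-identityʳ (b C d)))
  lucas zero (suc c) {b} {d} b<p d<p = mod-reflexive (trans
    (k>n⇒nCk≡0 (<-≤-trans b<p (≤-trans (m≤m+n p (c * p)) (m≤m+n (p + c * p) d))))
    (sym (cong (_* (b C d)) (k>n⇒nCk≡0 {0} {suc c} (s≤s z≤n)))))
  lucas (suc a) zero {b} {d} b<p d<p = mod-trans
    (subst (λ t → t C d ≡ (a * p + b) C d [mod p ]) (sym (+-assoc p (a * p) b)) (C-row-lo (a * p + b) d<p))
    (lucas a zero b<p d<p)
  lucas (suc a) (suc c) {b} {d} b<p d<p = mod-trans
    (subst₂ (λ s t → s C t ≡ (a * p + b) C (p + (c * p + d)) + (a * p + b) C (c * p + d) [mod p ])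
      (sym (+-assoc p (a * p) b)) (sym (+-assoc p (c * p) d)) (C-row-hi (a * p + b) (c * p + d)))
    (mod-trans
      (mod-+ (subst (λ t → (a * p + b) C t ≡ (a C suc c) * (b C d) [mod p ]) (+-assoc p (c * p) d) (lucas a (suc c) b<p d<p))
             (lucas a c b<p d<p))
      (mod-reflexive (trans (r (a C suc c) (a C c) (b C d)) (cong (_* (b C d)) (nCk+nC[k+1]≡[n+1]C[k+1] a c)))))
    where
    r : ∀ x y z → x * z + y * z ≡ (y + x) * z
    r = solve-∀

  valuation : ∀ n → 0 < n → ∃₂ λ v m → n ≡ p ^ v * m × ¬ p ∣ m
  valuation n 0<n = go n 0<n (<-wellFounded n)
    where
    go : ∀ n → 0 < n → Acc _<_ n → ∃₂ λ v m → n ≡ p ^ v * m × ¬ p ∣ m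
    go n 0<n (acc rec) with p ∣? n
    ... | no p∤n = 0 , n , sym (+-identityʳ n) , p∤n
    ... | yes (divides zero refl) = contradiction 0<n λ ()
    ... | yes (divides q@(suc _) refl) with go q z<s (rec (m<m*n q p 1<p))
    ...   | v , m , q≡ , p∤m = suc v , m , trans (cong (_* p) q≡) (r (p ^ v) m p) , p∤m
      where
      r : ∀ x m p → x * m * p ≡ p * x * m
      r = solve-∀

  -- Lucas' theorem with lowest digits 0 strips a common factor p from both indices, until m C 1 = m
  -- is left.
  p∤[p^v*m]C[p^v] : ∀ v {m} → ¬ p ∣ m → ¬ p ∣ (p ^ v * m) C (p ^ v)
  p∤[p^v*m]C[p^v] zero {m} p∤m p∣ = p∤m (subst (p ∣_) (trans (nC1≡n (m + 0)) (+-identityʳ m)) p∣)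
  p∤[p^v*m]C[p^v] (suc v) {m} p∤m p∣ = p∤[p^v*m]C[p^v] v p∤m (subst (p ∣_) (*-identityʳ _)
    (mod-resp-∣ (lucas (p ^ v * m) (p ^ v) 0<p 0<p)
      (subst₂ (λ s t → p ∣ s C t) (trans (*-assoc p (p ^ v) m) (shift (p ^ v * m))) (shift (p ^ v)) p∣)))
    where
    shift : ∀ x → p * x ≡ x * p + 0
    shift x = trans (*-comm p x) (sym (+-identityʳ (x * p)))

  -- The exponent is the p-adic valuation of a. It selects the digit to borrow from in
  -- `smaller-index`, and the index k in `mersenne?`.
  ∃[p^e]p∤aC[p^e] : ∀ a → 0 < a → ∃[ e ] (p ^ e ≤ a × ¬ p ∣ a C (p ^ e))
  ∃[p^e]p∤aC[p^e] a 0<a with valuation a 0<a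
  ... | v , zero    , _    , p∤0 = contradiction (p ∣0) p∤0
  ... | v , m@(suc _) , refl , p∤m = v , m≤m*n (p ^ v) m , p∤[p^v*m]C[p^v] v p∤m

  -- If p divides k, Lucas' theorem lowers r. If not, k C(p^r, k) = p^r C(p^r - 1, k - 1) already
  -- suffices.
  p∣[p^r]Ck : ∀ r {k} → 0 < k → k < p ^ r → p ∣ (p ^ r) C k
  p∣[p^r]Ck zero 0<k k<1 = contradiction (<-≤-trans k<1 0<k) (<-irrefl refl)
  p∣[p^r]Ck (suc r) {k} 0<k k<p^r with p ∣? k
  ... | yes (divides c refl) = mod-resp-∣ (mod-sym (subst₂ (λ s t → s C t ≡ (p ^ r C c) * 1 [mod p ])
            (trans (+-identityʳ _) (*-comm (p ^ r) p)) (+-identityʳ (c * p)) (lucas (p ^ r) c 0<p 0<p)))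
          (∣m⇒∣m*n 1 (p∣[p^r]Ck r 0<c c<p^r))
    where
    0<c : 0 < c
    0<c = *-cancelʳ-< p 0 c 0<k
    c<p^r : c < p ^ r
    c<p^r = *-cancelʳ-< p c (p ^ r) (subst (c * p <_) (*-comm p (p ^ r)) k<p^r)
  ... | no p∤k with k
  ...   | zero = contradiction 0<k λ ()
  ...   | suc k′ = prime∣*∤⇒∣ (suc k′) ((p ^ suc r) C suc k′)
            (subst (p ∣_) (sym (absorption (p ^ suc r) {{m^n≢0 p (suc r)}} k′)) (∣m⇒∣m*n _ (m∣m*n (p ^ r)))) p∤k

  -- The entries 1, ..., p-1 of row n + 1 vanish modulo p, so consecutive entries of row n are
  -- negatives of each other and all are ±1.
  p∣1+n⇒p∤nCk : ∀ {n} k → p ∣ suc n → k < p → ¬ p ∣ n C k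
  p∣1+n⇒p∤nCk zero p∣1+n k<p = prime∤1
  p∣1+n⇒p∤nCk {n} (suc k) p∣1+n k<p p∣C = p∣1+n⇒p∤nCk k p∣1+n (<-trans (n<1+n k) k<p)
    (∣m+n∣m⇒∣n (subst (p ∣_) (trans (sym (nCk+nC[k+1]≡[n+1]C[k+1] n k)) (+-comm (n C k) _))
      (prime∣*∤⇒∣ (suc k) (suc n C suc k)
        (subst (p ∣_) (sym ([1+k]*C≡[1+n]*C n k)) (∣m⇒∣m*n (n C k) p∣1+n)) (p∤1+k k<p))) p∣C)

  -- From p C(n+1, p) = (n+1) C(n, p-1). Together with `p∣1+n⇒p∤nCk` this decides the index j = 1.
  p∤1+n⇒p∣nC[p-1] : ∀ {n} → ¬ p ∣ suc n → p ∣ n C (pred p)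
  p∤1+n⇒p∣nC[p-1] {n} p∤1+n = prime∣*∤⇒∣ (suc n) (n C pred p)
    (subst (p ∣_) ([1+k]*C≡[1+n]*C n (pred p)) (subst (λ t → p ∣ t * (suc n C t)) (sym (suc-pred p)) (m∣m*n (suc n C p)))) p∤1+n

-- Binomial convolution and power sums modulo a prime

-- Used over ℕ for congruences of power sums and over ℚ for Bernoulli numbers; a semiring covers
-- both.
module BinomialConvolution
  {A : Set} {_⊕_ _⊗_ : A → A → A} {𝟘 𝟙 : A}
  (isCommutativeSemiring : IsCommutativeSemiring _≡_ _⊕_ _⊗_ 𝟘 𝟙)
  (ι : ℕ → A) (ι-+ : ∀ m n → ι (m + n) ≡ ι m ⊕ ι n) (ι-0 : ι 0 ≡ 𝟘) (ι-1 : ι 1 ≡ 𝟙)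
  where

  private
    module A = IsCommutativeSemiring isCommutativeSemiring

    ⊕-commutativeSemigroup : CommutativeSemigroup 0ℓ 0ℓ
    ⊕-commutativeSemigroup = record { isCommutativeSemigroup = A.+-isCommutativeSemigroup }

    open CommutativeSemigroupProperties ⊕-commutativeSemigroup using (interchange)

    infixl 6 _⊞_
    infixl 7 _⊠_
    _⊞_ _⊠_ : A → A → A
    _⊞_ = _⊕_
    _⊠_ = _⊗_

  ∑ : ℕ → (ℕ → A) → A
  ∑ zero    f = 𝟘
  ∑ (suc n) f = f 0 ⊞ ∑ n (f ∘ suc)

  ∑-cong : ∀ n {f g} → (∀ i → i < n → f i ≡ g i) → ∑ n f ≡ ∑ n g
  ∑-cong zero    eq = refl
  ∑-cong (suc n) eq = cong₂ _⊞_ (eq 0 z<s) (∑-cong n (λ i i<n → eq (suc i) (s<s i<n)))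

  ∑-+ : ∀ n f g → ∑ n (λ i → f i ⊞ g i) ≡ ∑ n f ⊞ ∑ n g
  ∑-+ zero    f g = sym (A.+-identityˡ 𝟘)
  ∑-+ (suc n) f g = trans (cong (f 0 ⊞ g 0 ⊞_) (∑-+ n (f ∘ suc) (g ∘ suc))) (interchange (f 0) (g 0) _ _)

  ∑-* : ∀ n a f → ∑ n (λ i → a ⊠ f i) ≡ a ⊠ ∑ n f
  ∑-* zero    a f = sym (A.zeroʳ a)
  ∑-* (suc n) a f = trans (cong (a ⊠ f 0 ⊞_) (∑-* n a (f ∘ suc))) (sym (A.distribˡ a (f 0) _))

  ∑-last : ∀ n f → ∑ (suc n) f ≡ ∑ n f ⊞ f n
  ∑-last zero    f = A.+-comm (f 0) 𝟘
  ∑-last (suc n) f = trans (cong (f 0 ⊞_) (∑-last n (f ∘ suc))) (sym (A.+-assoc (f 0) _ (f (suc n))))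

  -- The sequence n ↦ ∑_{j ≤ n} (n C j) a_j b_{n-j}, defined by the Leibniz rule for the shift:
  -- it is the product of exponential generating functions.
  conv : (ℕ → A) → (ℕ → A) → ℕ → A
  conv a b zero    = a 0 ⊠ b 0
  conv a b (suc n) = conv (a ∘ suc) b n ⊞ conv a (b ∘ suc) n

  conv-cong : ∀ {a a′ b b′} n → (∀ i → a i ≡ a′ i) → (∀ i → b i ≡ b′ i) → conv a b n ≡ conv a′ b′ n
  conv-cong zero    a≡ b≡ = cong₂ _⊠_ (a≡ 0) (b≡ 0)
  conv-cong (suc n) a≡ b≡ = cong₂ _⊞_ (conv-cong n (a≡ ∘ suc) b≡) (conv-cong n a≡ (b≡ ∘ suc))

  conv-comm : ∀ a b n → conv a b n ≡ conv b a n
  conv-comm a b zero    = A.*-comm (a 0) (b 0)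
  conv-comm a b (suc n) = trans (A.+-comm _ _) (cong₂ _⊞_ (conv-comm a (b ∘ suc) n) (conv-comm (a ∘ suc) b n))

  conv-+ʳ : ∀ a b c n → conv a (λ i → b i ⊞ c i) n ≡ conv a b n ⊞ conv a c n
  conv-+ʳ a b c zero    = A.distribˡ (a 0) (b 0) (c 0)
  conv-+ʳ a b c (suc n) = trans (cong₂ _⊞_ (conv-+ʳ (a ∘ suc) b c n) (conv-+ʳ a (b ∘ suc) (c ∘ suc) n)) (interchange _ _ _ _)

  conv-+ˡ : ∀ a b c n → conv (λ i → a i ⊞ b i) c n ≡ conv a c n ⊞ conv b c n
  conv-+ˡ a b c n = trans (conv-comm _ c n) (trans (conv-+ʳ c a b n) (cong₂ _⊞_ (conv-comm c a n) (conv-comm c b n)))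

  conv-*ˡ : ∀ x a b n → conv (λ i → x ⊠ a i) b n ≡ x ⊠ conv a b n
  conv-*ˡ x a b zero    = A.*-assoc x (a 0) (b 0)
  conv-*ˡ x a b (suc n) = trans (cong₂ _⊞_ (conv-*ˡ x (a ∘ suc) b n) (conv-*ˡ x a (b ∘ suc) n)) (sym (A.distribˡ x _ _))

  conv-zeroˡ : ∀ b n → conv (λ _ → 𝟘) b n ≡ 𝟘
  conv-zeroˡ b zero    = A.zeroˡ (b 0)
  conv-zeroˡ b (suc n) = trans (cong₂ _⊞_ (conv-zeroˡ b n) (conv-zeroˡ (b ∘ suc) n)) (A.+-identityˡ 𝟘)

  -- By the Leibniz rule, both sides at n + 1 are the sum of three products at n in which one of the
  -- factors is shifted. No double sums arise.
  conv-assoc : ∀ a b c n → conv (conv a b) c n ≡ conv a (conv b c) n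
  conv-assoc a b c zero    = A.*-assoc (a 0) (b 0) (c 0)
  conv-assoc a b c (suc n) = begin
    conv (λ i → conv (a ∘ suc) b i ⊞ conv a (b ∘ suc) i) c n ⊞ conv (conv a b) (c ∘ suc) n
      ≡⟨ cong (_⊞ conv (conv a b) (c ∘ suc) n) (conv-+ˡ _ _ c n) ⟩
    conv (conv (a ∘ suc) b) c n ⊞ conv (conv a (b ∘ suc)) c n ⊞ conv (conv a b) (c ∘ suc) n
      ≡⟨ cong₂ _⊞_ (cong₂ _⊞_ (conv-assoc (a ∘ suc) b c n) (conv-assoc a (b ∘ suc) c n)) (conv-assoc a b (c ∘ suc) n) ⟩
    conv (a ∘ suc) (conv b c) n ⊞ conv a (conv (b ∘ suc) c) n ⊞ conv a (conv b (c ∘ suc)) n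
      ≡⟨ A.+-assoc _ _ _ ⟩
    conv (a ∘ suc) (conv b c) n ⊞ (conv a (conv (b ∘ suc) c) n ⊞ conv a (conv b (c ∘ suc)) n)
      ≡⟨ cong (conv (a ∘ suc) (conv b c) n ⊞_) (conv-+ʳ a _ _ n) ⟨
    conv (a ∘ suc) (conv b c) n ⊞ conv a (λ i → conv (b ∘ suc) c i ⊞ conv b (c ∘ suc) i) n ∎
    where open ≡-Reasoning

  conv-∑ : ∀ a b n → conv a b n ≡ ∑ (suc n) (λ j → ι (n C j) ⊠ (a j ⊠ b (n ∸ j)))
  conv-∑ a b zero = sym (trans (A.+-identityʳ _) (trans (cong (_⊠ (a 0 ⊠ b 0)) ι-1) (A.*-identityˡ _)))
  conv-∑ a b (suc n) = begin
    conv (a ∘ suc) b n ⊞ conv a (b ∘ suc) n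
      ≡⟨ cong₂ _⊞_ (conv-∑ (a ∘ suc) b n) (conv-∑ a (b ∘ suc) n) ⟩
    ∑ (suc n) t ⊞ ∑ (suc n) (λ j → ι (n C j) ⊠ (a j ⊠ b (suc (n ∸ j))))
      ≡⟨ cong (∑ (suc n) t ⊞_) (∑-cong (suc n) λ j j<1+n →
           cong (λ i → ι (n C j) ⊠ (a j ⊠ b i)) (sym (+-∸-assoc 1 (s≤s⁻¹ j<1+n)))) ⟩
    ∑ (suc n) t ⊞ ∑ (suc n) u
      ≡⟨ cong (∑ (suc n) t ⊞_) (A.+-identityʳ _) ⟨
    ∑ (suc n) t ⊞ (∑ (suc n) u ⊞ 𝟘)
      -- A vanishing term with n C (n+1) is appended, so that splitting off the first term leaves
      -- two sums of equal length for Pascal's rule.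
      ≡⟨ cong (λ z → ∑ (suc n) t ⊞ (∑ (suc n) u ⊞ z)) u[1+n]≡𝟘 ⟨
    ∑ (suc n) t ⊞ (∑ (suc n) u ⊞ u (suc n))
      ≡⟨ cong (∑ (suc n) t ⊞_) (∑-last (suc n) u) ⟨
    ∑ (suc n) t ⊞ (u 0 ⊞ ∑ (suc n) (u ∘ suc))
      ≡⟨ A.+-assoc _ _ _ ⟨
    ∑ (suc n) t ⊞ u 0 ⊞ ∑ (suc n) (u ∘ suc)
      ≡⟨ cong (_⊞ ∑ (suc n) (u ∘ suc)) (A.+-comm _ (u 0)) ⟩
    u 0 ⊞ ∑ (suc n) t ⊞ ∑ (suc n) (u ∘ suc)
      ≡⟨ A.+-assoc _ _ _ ⟩
    u 0 ⊞ (∑ (suc n) t ⊞ ∑ (suc n) (u ∘ suc))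
      ≡⟨ cong (u 0 ⊞_) (∑-+ (suc n) t (u ∘ suc)) ⟨
    u 0 ⊞ ∑ (suc n) (λ j → t j ⊞ u (suc j))
      ≡⟨ cong (u 0 ⊞_) (∑-cong (suc n) λ j _ → trans (sym (A.distribʳ _ _ _))
           (cong (_⊠ (a (suc j) ⊠ b (n ∸ j))) (trans (sym (ι-+ (n C j) (n C suc j))) (cong ι (nCk+nC[k+1]≡[n+1]C[k+1] n j))))) ⟩
    ∑ (2 + n) (λ j → ι (suc n C j) ⊠ (a j ⊠ b (suc n ∸ j))) ∎
    where
    open ≡-Reasoning
    t u : ℕ → A
    t j = ι (n C j) ⊠ (a (suc j) ⊠ b (n ∸ j))
    u j = ι (n C j) ⊠ (a j ⊠ b (suc n ∸ j))
    u[1+n]≡𝟘 : u (suc n) ≡ 𝟘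
    u[1+n]≡𝟘 = trans (cong (λ c → ι c ⊠ (a (suc n) ⊠ b (n ∸ n))) (k>n⇒nCk≡0 (n<1+n n))) (trans (cong (_⊠ _) ι-0) (A.zeroˡ _))

  pow : A → ℕ → A
  pow x zero    = 𝟙
  pow x (suc n) = x ⊠ pow x n

  one : ℕ → A
  one _ = 𝟙

  conv-pow-one : ∀ x n → conv (pow x) one n ≡ pow (x ⊞ 𝟙) n
  conv-pow-one x zero    = A.*-identityˡ 𝟙
  conv-pow-one x (suc n) = begin
    conv (λ i → x ⊠ pow x i) one n ⊞ conv (pow x) one n ≡⟨ cong (_⊞ conv (pow x) one n) (conv-*ˡ x (pow x) one n) ⟩
    x ⊠ conv (pow x) one n ⊞ conv (pow x) one n         ≡⟨ cong (x ⊠ conv (pow x) one n ⊞_) (A.*-identityˡ _) ⟨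
    x ⊠ conv (pow x) one n ⊞ 𝟙 ⊠ conv (pow x) one n     ≡⟨ A.distribʳ _ x 𝟙 ⟨
    (x ⊞ 𝟙) ⊠ conv (pow x) one n                        ≡⟨ cong ((x ⊞ 𝟙) ⊠_) (conv-pow-one x n) ⟩
    (x ⊞ 𝟙) ⊠ pow (x ⊞ 𝟙) n                             ∎
    where open ≡-Reasoning

  -- The sequence `ι` has exponential generating function t e^t, and e^(xt) t e^t = t e^((x+1)t).
  conv-pow-ι : ∀ x n → conv (pow x) ι (suc n) ≡ ι (suc n) ⊠ pow (x ⊞ 𝟙) n
  conv-pow-ι x zero = begin
    x ⊠ 𝟙 ⊠ ι 0 ⊞ 𝟙 ⊠ ι 1 ≡⟨ cong₂ _⊞_ (trans (cong (x ⊠ 𝟙 ⊠_) ι-0) (A.zeroʳ _)) (A.*-comm 𝟙 (ι 1)) ⟩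
    𝟘 ⊞ ι 1 ⊠ 𝟙           ≡⟨ A.+-identityˡ _ ⟩
    ι 1 ⊠ 𝟙               ∎
    where open ≡-Reasoning
  conv-pow-ι x (suc n) = begin
    conv (λ i → x ⊠ pow x i) ι (suc n) ⊞ conv (pow x) (ι ∘ suc) (suc n)
      ≡⟨ cong₂ _⊞_ (conv-*ˡ x (pow x) ι (suc n)) (conv-cong (suc n) (λ _ → refl) ι-suc) ⟩
    x ⊠ c ⊞ conv (pow x) (λ i → 𝟙 ⊞ ι i) (suc n)
      ≡⟨ cong (x ⊠ c ⊞_) (trans (conv-+ʳ (pow x) one ι (suc n)) (A.+-comm _ c)) ⟩
    x ⊠ c ⊞ (c ⊞ conv (pow x) one (suc n))
      ≡⟨ A.+-assoc _ c _ ⟨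
    x ⊠ c ⊞ c ⊞ conv (pow x) one (suc n)
      ≡⟨ cong₂ _⊞_ (trans (cong (x ⊠ c ⊞_) (sym (A.*-identityˡ c))) (sym (A.distribʳ c x 𝟙))) (conv-pow-one x (suc n)) ⟩
    (x ⊞ 𝟙) ⊠ c ⊞ pow (x ⊞ 𝟙) (suc n)
      ≡⟨ cong (λ z → (x ⊞ 𝟙) ⊠ z ⊞ pow (x ⊞ 𝟙) (suc n)) (conv-pow-ι x n) ⟩
    (x ⊞ 𝟙) ⊠ (ι (suc n) ⊠ pow (x ⊞ 𝟙) n) ⊞ pow (x ⊞ 𝟙) (suc n)
      ≡⟨ cong (_⊞ pow (x ⊞ 𝟙) (suc n)) (trans (sym (A.*-assoc _ _ _)) (trans (cong (_⊠ pow (x ⊞ 𝟙) n) (A.*-comm _ _)) (A.*-assoc _ _ _))) ⟩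
    ι (suc n) ⊠ pow (x ⊞ 𝟙) (suc n) ⊞ pow (x ⊞ 𝟙) (suc n)
      ≡⟨ A.+-comm _ _ ⟩
    pow (x ⊞ 𝟙) (suc n) ⊞ ι (suc n) ⊠ pow (x ⊞ 𝟙) (suc n)
      ≡⟨ cong (_⊞ ι (suc n) ⊠ pow (x ⊞ 𝟙) (suc n)) (A.*-identityˡ _) ⟨
    𝟙 ⊠ pow (x ⊞ 𝟙) (suc n) ⊞ ι (suc n) ⊠ pow (x ⊞ 𝟙) (suc n)
      ≡⟨ A.distribʳ _ 𝟙 (ι (suc n)) ⟨
    (𝟙 ⊞ ι (suc n)) ⊠ pow (x ⊞ 𝟙) (suc n)
      ≡⟨ cong (_⊠ pow (x ⊞ 𝟙) (suc n)) (ι-suc (suc n)) ⟨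
    ι (2 + n) ⊠ pow (x ⊞ 𝟙) (suc n) ∎
    where
    open ≡-Reasoning
    c : A
    c = conv (pow x) ι (suc n)
    ι-suc : ∀ i → ι (suc i) ≡ 𝟙 ⊞ ι i
    ι-suc i = trans (ι-+ 1 i) (cong (_⊞ ι i) ι-1)

module ℕ-Conv = BinomialConvolution +-*-isCommutativeSemiring id (λ _ _ → refl) refl refl
open ℕ-Conv using () renaming (∑ to ∑ℕ; conv to convℕ; pow to powℕ; conv-∑ to conv-∑ℕ; ∑-last to ∑-lastℕ)

-- Fermat's theorem and power sums modulo p

module _ {p : ℕ} where

  mod-∑-0 : ∀ n {f} → (∀ i → i < n → f i ≡ 0 [mod p ]) → ∑ℕ n f ≡ 0 [mod p ]
  mod-∑-0 zero    f≡0 = mod-reflexive refl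
  mod-∑-0 (suc n) f≡0 = mod-+ (f≡0 0 z<s) (mod-∑-0 n (λ i i<n → f≡0 (suc i) (s<s i<n)))

  mod-^ : ∀ {a b} k → a ≡ b [mod p ] → a ^ k ≡ b ^ k [mod p ]
  mod-^ zero    a≡b = mod-reflexive refl
  mod-^ (suc k) a≡b = mod-* a≡b (mod-^ k a≡b)

powℕ≡^ : ∀ x n → powℕ x n ≡ x ^ n
powℕ≡^ x zero    = refl
powℕ≡^ x (suc n) = cong (x *_) (powℕ≡^ x n)

binomial-theorem : ∀ x n → convℕ (x ^_) (λ _ → 1) n ≡ suc x ^ n
binomial-theorem x n = begin
  convℕ (x ^_) (λ _ → 1) n ≡⟨ ℕ-Conv.conv-cong n (λ i → sym (powℕ≡^ x i)) (λ _ → refl) ⟩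
  convℕ (powℕ x) (λ _ → 1) n ≡⟨ ℕ-Conv.conv-pow-one x n ⟩
  powℕ (x + 1) n             ≡⟨ powℕ≡^ (x + 1) n ⟩
  (x + 1) ^ n                ≡⟨ cong (_^ n) (+-comm x 1) ⟩
  suc x ^ n                  ∎
  where open ≡-Reasoning

-- Summing the binomial theorem over 1, ..., x gives 2^m + ... + (x+1)^m; the `suc` supplies the
-- missing 1^m.
powerSum-telescope : ∀ x m → suc (convℕ (λ k → powerSum k x) (λ _ → 1) m) ≡ powerSum m (suc x)
powerSum-telescope zero m = trans (cong suc (ℕ-Conv.conv-zeroˡ (λ _ → 1) m)) (sym (^-zeroˡ m))
powerSum-telescope (suc x) m = begin
  suc (convℕ (λ k → powerSum k x + suc x ^ k) (λ _ → 1) m)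
    ≡⟨ cong suc (ℕ-Conv.conv-+ˡ (λ k → powerSum k x) (suc x ^_) (λ _ → 1) m) ⟩
  suc (convℕ (λ k → powerSum k x) (λ _ → 1) m) + convℕ (suc x ^_) (λ _ → 1) m
    ≡⟨ cong₂ _+_ (powerSum-telescope x m) (binomial-theorem (suc x) m) ⟩
  powerSum m (2 + x) ∎
  where open ≡-Reasoning

powerSum-mod : ∀ {p} k l → (∀ x → suc x ^ k ≡ suc x ^ l [mod p ]) → ∀ x → powerSum k x ≡ powerSum l x [mod p ]
powerSum-mod k l eq zero    = mod-reflexive refl
powerSum-mod k l eq (suc x) = mod-+ (powerSum-mod k l eq x) (eq x)

module _ {p : ℕ} (pr : Prime p) where

  private
    instance
      p≢0 : NonZero p
      p≢0 = prime⇒nonZero pr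

  fermat : ∀ x → x ^ p ≡ x [mod p ]
  fermat zero    = mod-reflexive (subst (λ q → 0 ^ q ≡ 0) (suc-pred p) refl)
  fermat (suc x) = subst (_≡ suc x [mod p ]) (trans (sym (conv-∑ℕ (x ^_) (λ _ → 1) p)) (binomial-theorem x p))
    (subst (λ q → f 0 + ∑ℕ q (f ∘ suc) ≡ suc x [mod p ]) (suc-pred p)
      (mod-+ (mod-reflexive refl)
        (subst (_≡ x [mod p ]) (sym (∑-lastℕ (pred p) (f ∘ suc)))
          (mod-+ (mod-∑-0 (pred p) λ i i<p-1 → ∣⇒≡0 (∣m⇒∣m*n _ (p∣pCk pr z<s (subst (suc i <_) (suc-pred p) (s<s i<p-1)))))
            (subst (λ q → f q ≡ x [mod p ]) (sym (suc-pred p))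
              (mod-trans (mod-reflexive (trans (cong (_* (x ^ p * 1)) (nCn≡1 p)) (trans (+-identityʳ _) (*-identityʳ _)))) (fermat x)))))))
    where
    f : ℕ → ℕ
    f j = (p C j) * (x ^ j * 1)

  fermat-unit : ∀ {x} → ¬ p ∣ x → x ^ pred p ≡ 1 [mod p ]
  fermat-unit {zero}      p∤x = contradiction (p ∣0) p∤x
  fermat-unit {x@(suc _)} p∤x = subst (_≡ 1 [mod p ]) 1+z≡x^[p-1]
    (mod-+ {a = 1} (mod-reflexive refl) (∣⇒≡0 (prime∣*∤⇒∣ pr x z (≡0⇒∣ (mod-cancelʳ-+ x xz+x≡x)) p∤x)))
    where
    -- `z` is x^(p-1) - 1; the power is positive, so the predecessor is exact.
    z : ℕ
    z = pred (x ^ pred p)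
    1+z≡x^[p-1] : suc z ≡ x ^ pred p
    1+z≡x^[p-1] = suc-pred (x ^ pred p) {{m^n≢0 x (pred p)}}
    xz+x≡x : x * z + x ≡ x [mod p ]
    xz+x≡x = subst (_≡ x [mod p ])
      (trans (trans (cong (x ^_) (sym (suc-pred p))) (cong (x *_) (sym 1+z≡x^[p-1]))) (trans (*-suc x z) (+-comm x (x * z))))
      (fermat x)

  -- Telescoping at x = p expresses the power sum of exponent k + 1, modulo p, by those of exponents
  -- 0, ..., k + 1. The one of exponent k + 1 cancels and those below k vanish by induction, which
  -- leaves k + 1 times the one of exponent k. No primitive root is involved.
  powerSum≡0 : ∀ k → suc k < p → powerSum k p ≡ 0 [mod p ]
  powerSum≡0 = <-rec _ λ k ih 1+k<p → ∣⇒≡0 (prime∣*∤⇒∣ pr (suc k) (powerSum k p)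
    (≡0⇒∣ (mod-cancelʳ-+ (powerSum (suc k) p) (step k ih 1+k<p))) (p∤1+k pr 1+k<p))
    where
    a : ℕ → ℕ
    a k = powerSum k p
    f : ℕ → ℕ → ℕ
    f m j = (m C j) * (a j * 1)
    total : ∀ m → ∑ℕ (suc m) (f m) ≡ a m [mod p ]
    total m = mod-cancelʳ-+ 1 (mod-trans
      (mod-reflexive (trans (+-comm _ 1) (trans (cong suc (sym (conv-∑ℕ a (λ _ → 1) m))) (powerSum-telescope p m))))
      (mod-+ (mod-reflexive refl) (subst (suc p ^ m ≡_[mod p ]) (^-zeroˡ m) (mod-^ m (0 , 1 , refl)))))
    step : ∀ k → (∀ {j} → j < k → suc j < p → powerSum j p ≡ 0 [mod p ]) → suc k < p →
           suc k * a k + a (suc k) ≡ 0 + a (suc k) [mod p ]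
    step k ih 1+k<p = mod-trans
      (mod-+ (mod-trans (mod-sym (mod-+ low (mod-reflexive top))) (mod-reflexive (sym (∑-lastℕ k (f (suc k)))))) (mod-reflexive last))
      (mod-trans (mod-reflexive (sym (∑-lastℕ (suc k) (f (suc k))))) (total (suc k)))
      where
      low : ∑ℕ k (f (suc k)) ≡ 0 [mod p ]
      low = mod-∑-0 k λ i i<k → ∣⇒≡0 (∣n⇒∣m*n (suc k C i) (∣m⇒∣m*n 1 (≡0⇒∣ (ih i<k (<-trans (s<s i<k) 1+k<p)))))
      top : f (suc k) k ≡ suc k * a k
      top = cong₂ _*_ ([1+n]Cn≡1+n k) (*-identityʳ (a k))
      last : a (suc k) ≡ f (suc k) (suc k)
      last = sym (trans (cong (_* (a (suc k) * 1)) (nCn≡1 (suc k))) (trans (*-identityˡ _) (*-identityʳ _)))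

  -- The smaller exponent is a successor because y^(a+p-1) ≡ y^a requires a > 0 when p divides y.
  powerSum-period : ∀ k q x → powerSum (suc k + q * pred p) x ≡ powerSum (suc k) x [mod p ]
  powerSum-period k zero    x = mod-reflexive (cong (λ t → powerSum t x) (+-identityʳ (suc k)))
  powerSum-period k (suc q) x = mod-trans (powerSum-mod _ (suc k + q * pred p) step x) (powerSum-period k q x)
    where
    step : ∀ y → suc y ^ (suc k + (pred p + q * pred p)) ≡ suc y ^ (suc k + q * pred p) [mod p ]
    step y = subst₂ (_≡_[mod p ])
      (trans (sym (^-distribˡ-+-* (suc y) p (k + q * pred p))) (cong (suc y ^_) (trans (cong (_+ (k + q * pred p)) (sym (suc-pred p))) (cong suc (r (pred p) k (q * pred p))))))
      refl
      (mod-* (fermat (suc y)) (mod-reflexive refl))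
      where
      r : ∀ a b c → a + (b + c) ≡ b + (a + c)
      r = solve-∀

  powerSum-[p-1] : ∀ x → x < p → powerSum (pred p) x ≡ x [mod p ]
  powerSum-[p-1] zero    x<p = mod-reflexive refl
  powerSum-[p-1] (suc x) x<p = subst (powerSum (pred p) (suc x) ≡_[mod p ]) (+-comm x 1)
    (mod-+ (powerSum-[p-1] x (<-trans (n<1+n x) x<p)) (fermat-unit (p∤1+k pr x<p)))

  0<p-1 : 0 < pred p
  0<p-1 = s<s⁻¹ (subst (1 <_) (sym (suc-pred p)) (nonTrivial⇒n>1 p {{prime⇒nonTrivial pr}}))

  ∤⇒p∣powerSum : ∀ k → ¬ pred p ∣ k → p ∣ powerSum k p
  ∤⇒p∣powerSum k p-1∤k = by-remainder (k % pred p) refl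
    where
    instance
      p-1≢0 : NonZero (pred p)
      p-1≢0 = >-nonZero 0<p-1
    by-remainder : ∀ r → k % pred p ≡ r → p ∣ powerSum k p
    by-remainder zero    eq = contradiction (m%n≡0⇒n∣m k (pred p) eq) p-1∤k
    by-remainder (suc r) eq = ≡0⇒∣ (subst (λ t → powerSum t p ≡ 0 [mod p ])
      (sym (trans (m≡m%n+[m/n]*n k (pred p)) (cong (_+ k / pred p * pred p) eq)))
      (mod-trans (powerSum-period r (k / pred p) p)
        (powerSum≡0 (suc r) (subst (2 + r <_) (suc-pred p) (s<s (subst (_< pred p) eq (m%n<n k (pred p))))))))

  ∣⇒p∤powerSum : ∀ k → 0 < k → pred p ∣ k → ¬ p ∣ powerSum k p
  ∣⇒p∤powerSum k 0<k (divides zero refl) = contradiction 0<k λ ()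
  ∣⇒p∤powerSum k 0<k (divides (suc q) refl) p∣S = p∤1+k pr {pred (pred p)} (subst (_< p) (sym p-1≡) (≤-reflexive (suc-pred p)))
      (subst (p ∣_) (sym p-1≡) (mod-resp-∣ (mod-trans periodic S≡p-1) p∣S))
    where
    p-1≡ : suc (pred (pred p)) ≡ pred p
    p-1≡ = suc-pred (pred p) {{>-nonZero 0<p-1}}
    periodic : powerSum (pred p + q * pred p) p ≡ powerSum (pred p) p [mod p ]
    periodic = subst (λ t → powerSum (t + q * pred p) p ≡ powerSum t p [mod p ]) p-1≡ (powerSum-period _ q p)
    -- The first p - 1 summands are 1 by Fermat, and the last one, p^(p-1), vanishes.
    S≡p-1 : powerSum (pred p) p ≡ pred p [mod p ]
    S≡p-1 = subst (λ t → powerSum (pred p) t ≡ pred p [mod p ]) (suc-pred p)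
      (subst (powerSum (pred p) (suc (pred p)) ≡_[mod p ]) (+-identityʳ (pred p))
        (mod-+ (powerSum-[p-1] (pred p) (≤-reflexive (suc-pred p)))
          (∣⇒≡0 (subst₂ (λ s t → s ∣ suc (pred p) ^ t) (suc-pred p) p-1≡ (m∣m*n {suc (pred p)} (suc (pred p) ^ pred (pred p)))))))

-- Bernoulli numbers and Faulhaber's formula

toℚᵘ-ℤtoℚ : ∀ z → toℚᵘ (ℤtoℚ z) ℚᵘ.≃ mkℚᵘ z 0
toℚᵘ-ℤtoℚ z = ℚ.toℚᵘ-fromℚᵘ (mkℚᵘ z 0)

ℤtoℚ-+ : ∀ a b → ℤtoℚ (a ℤ.+ b) ≡ ℤtoℚ a +ℚ ℤtoℚ b
ℤtoℚ-+ a b = ℚ.toℚᵘ-injective (begin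
  toℚᵘ (ℤtoℚ (a ℤ.+ b))                 ≈⟨ toℚᵘ-ℤtoℚ (a ℤ.+ b) ⟩
  mkℚᵘ (a ℤ.+ b) 0                      ≈⟨ *≡* (cong (ℤ._* pos 1) (sym (cong₂ ℤ._+_ (ℤ.*-identityʳ a) (ℤ.*-identityʳ b)))) ⟩
  mkℚᵘ a 0 ℚᵘ.+ mkℚᵘ b 0                ≈⟨ ℚᵘ.+-cong (toℚᵘ-ℤtoℚ a) (toℚᵘ-ℤtoℚ b) ⟨
  toℚᵘ (ℤtoℚ a) ℚᵘ.+ toℚᵘ (ℤtoℚ b)      ≈⟨ ℚ.toℚᵘ-homo-+ (ℤtoℚ a) (ℤtoℚ b) ⟨
  toℚᵘ (ℤtoℚ a +ℚ ℤtoℚ b)               ∎)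
  where open ℚᵘ.≃-Reasoning

ℤtoℚ-* : ∀ a b → ℤtoℚ (a ℤ.* b) ≡ ℤtoℚ a *ℚ ℤtoℚ b
ℤtoℚ-* a b = ℚ.toℚᵘ-injective (begin
  toℚᵘ (ℤtoℚ (a ℤ.* b))                 ≈⟨ toℚᵘ-ℤtoℚ (a ℤ.* b) ⟩
  mkℚᵘ (a ℤ.* b) 0                      ≈⟨ *≡* refl ⟩
  mkℚᵘ a 0 ℚᵘ.* mkℚᵘ b 0                ≈⟨ ℚᵘ.*-cong (toℚᵘ-ℤtoℚ a) (toℚᵘ-ℤtoℚ b) ⟨
  toℚᵘ (ℤtoℚ a) ℚᵘ.* toℚᵘ (ℤtoℚ b)      ≈⟨ ℚ.toℚᵘ-homo-* (ℤtoℚ a) (ℤtoℚ b) ⟨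
  toℚᵘ (ℤtoℚ a *ℚ ℤtoℚ b)               ∎)
  where open ℚᵘ.≃-Reasoning

ℤtoℚ-neg : ∀ a → ℤtoℚ (ℤ.- a) ≡ -ℚ ℤtoℚ a
ℤtoℚ-neg a = ℚ.toℚᵘ-injective (begin
  toℚᵘ (ℤtoℚ (ℤ.- a))       ≈⟨ toℚᵘ-ℤtoℚ (ℤ.- a) ⟩
  mkℚᵘ (ℤ.- a) 0            ≈⟨ ℚᵘ.-‿cong (toℚᵘ-ℤtoℚ a) ⟨
  ℚᵘ.- toℚᵘ (ℤtoℚ a)        ≈⟨ ℚ.toℚᵘ-homo‿- (ℤtoℚ a) ⟨
  toℚᵘ (-ℚ ℤtoℚ a)          ∎)
  where open ℚᵘ.≃-Reasoning

ℤtoℚ-injective : ∀ {a b} → ℤtoℚ a ≡ ℤtoℚ b → a ≡ b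
ℤtoℚ-injective {a} {b} eq with ℚᵘ.≃-trans (ℚᵘ.≃-sym (toℚᵘ-ℤtoℚ a)) (ℚᵘ.≃-trans (ℚ.toℚᵘ-cong eq) (toℚᵘ-ℤtoℚ b))
... | *≡* a*1≡b*1 = trans (sym (ℤ.*-identityʳ a)) (trans a*1≡b*1 (ℤ.*-identityʳ b))

ℕtoℚ-+ : ∀ m n → ℕtoℚ (m + n) ≡ ℕtoℚ m +ℚ ℕtoℚ n
ℕtoℚ-+ m n = ℤtoℚ-+ (pos m) (pos n)

ℕtoℚ-* : ∀ m n → ℕtoℚ (m * n) ≡ ℕtoℚ m *ℚ ℕtoℚ n
ℕtoℚ-* m n = trans (cong ℤtoℚ (ℤ.pos-* m n)) (ℤtoℚ-* (pos m) (pos n))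

ℕtoℚ-injective : ∀ {m n} → ℕtoℚ m ≡ ℕtoℚ n → m ≡ n
ℕtoℚ-injective eq = ℤ.+-injective (ℤtoℚ-injective eq)

opaque
  -- Opaque, so that `ι n` stays an atom in equations instead of unfolding to a normalised fraction;
  -- the homomorphism laws below replace its definition.
  ι : ℕ → ℚ
  ι = ℕtoℚ

  ι≡ℕtoℚ : ∀ n → ι n ≡ ℕtoℚ n
  ι≡ℕtoℚ n = refl

  ι-0 : ι 0 ≡ 0ℚ
  ι-0 = refl

  ι-1 : ι 1 ≡ 1ℚ
  ι-1 = refl

  ι-+ : ∀ m n → ι (m + n) ≡ ι m +ℚ ι n
  ι-+ = ℕtoℚ-+

  ι-* : ∀ m n → ι (m * n) ≡ ι m *ℚ ι n
  ι-* = ℕtoℚ-*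

  ι-injective : ∀ {m n} → ι m ≡ ι n → m ≡ n
  ι-injective = ℕtoℚ-injective

  -- Indexed by the predecessor of the denominator, so no nonzero condition is carried along.
  recip : ℕ → ℚ
  recip k = 1/_ (ι (suc k)) {{≢-nonZeroℚ (1+n≢0 ∘ ι-injective {suc k} {0})}}

  *-recip : ∀ k → ι (suc k) *ℚ recip k ≡ 1ℚ
  *-recip k = ℚ.*-inverseʳ (ι (suc k)) {{≢-nonZeroℚ (1+n≢0 ∘ ι-injective {suc k} {0})}}

ι-cancelˡ : ∀ k {a b} → ι (suc k) *ℚ a ≡ ι (suc k) *ℚ b → a ≡ b
ι-cancelˡ k {a} {b} eq = begin
  a                                 ≡⟨ expand a ⟩
  recip k *ℚ (ι (suc k) *ℚ a)    ≡⟨ cong (recip k *ℚ_) eq ⟩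
  recip k *ℚ (ι (suc k) *ℚ b)    ≡⟨ expand b ⟨
  b                                 ∎
  where
  open ≡-Reasoning
  expand : ∀ c → c ≡ recip k *ℚ (ι (suc k) *ℚ c)
  expand c = begin
    c                              ≡⟨ ℚ.*-identityˡ c ⟨
    1ℚ *ℚ c                        ≡⟨ cong (_*ℚ c) (*-recip k) ⟨
    ι (suc k) *ℚ recip k *ℚ c   ≡⟨ solve 3 (λ x y z → x :* y :* z := y :* (x :* z)) refl (ι (suc k)) (recip k) c ⟩
    recip k *ℚ (ι (suc k) *ℚ c) ∎

module ℚ-Conv = BinomialConvolution (IsCommutativeRing.isCommutativeSemiring ℚ.+-*-isCommutativeRing) ι ι-+ ι-0 ι-1
open ℚ-Conv

opaque
  -- Makes the recursion over all smaller indices structural: table t is meaningful at indices below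
  -- t. The recurrence is the one that Faulhaber's formula imposes at x = 1.
  bernoulliTable : ℕ → ℕ → ℚ
  bernoulliTable zero    _ = 0ℚ
  bernoulliTable (suc t) k with k <? t
  ... | yes _ = bernoulliTable t k
  ... | no  _ = 1ℚ -ℚ recip t *ℚ ∑ t (λ j → ι (suc t C j) *ℚ bernoulliTable t j)

  -- The Bernoulli numbers with B₁ = + ½.
  B : ℕ → ℚ
  B k = bernoulliTable (suc k) k

  bernoulliTable≡B : ∀ t k → k < t → bernoulliTable t k ≡ B k
  bernoulliTable≡B (suc t) k k<1+t with k <? t
  ... | yes k<t = bernoulliTable≡B t k k<t
  ... | no  k≮t with ≤-antisym (s≤s⁻¹ k<1+t) (≮⇒≥ k≮t)
  ...   | refl with k <? k
  ...     | yes k<k = contradiction k<k (<-irrefl refl)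
  ...     | no  _   = refl

  B-step : ∀ t → B t ≡ 1ℚ -ℚ recip t *ℚ ∑ t (λ j → ι (suc t C j) *ℚ B j)
  B-step t with t <? t
  ... | yes t<t = contradiction t<t (<-irrefl refl)
  ... | no  _   = cong (λ s → 1ℚ -ℚ recip t *ℚ s)
    (∑-cong t λ j j<t → cong (ι (suc t C j) *ℚ_) (bernoulliTable≡B t j j<t))

∑-C*B : ∀ t → ∑ (suc t) (λ j → ι (suc t C j) *ℚ B j) ≡ ι (suc t)
∑-C*B t = begin
  ∑ (suc t) f                                              ≡⟨ ∑-last t f ⟩
  s +ℚ ι (suc t C t) *ℚ B t                             ≡⟨ cong₂ (λ c b → s +ℚ ι c *ℚ b) ([1+n]Cn≡1+n t) (B-step t) ⟩
  s +ℚ ι (suc t) *ℚ (1ℚ -ℚ recip t *ℚ s)                ≡⟨ solve 3 (λ s n r → s :+ n :* (con 1ℚ :- r :* s) := n :+ s :* (con 1ℚ :- n :* r)) refl s (ι (suc t)) (recip t) ⟩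
  ι (suc t) +ℚ s *ℚ (1ℚ -ℚ ι (suc t) *ℚ recip t)     ≡⟨ cong (λ u → ι (suc t) +ℚ s *ℚ (1ℚ -ℚ u)) (*-recip t) ⟩
  ι (suc t) +ℚ s *ℚ (1ℚ -ℚ 1ℚ)                          ≡⟨ cong (λ u → ι (suc t) +ℚ u) (ℚ.*-zeroʳ s) ⟩
  ι (suc t) +ℚ 0ℚ                                       ≡⟨ ℚ.+-identityʳ _ ⟩
  ι (suc t)                                             ∎
  where
  open ≡-Reasoning
  f : ℕ → ℚ
  f j = ι (suc t C j) *ℚ B j
  s : ℚ
  s = ∑ t f

-- In generating functions e^t B(t) = t e^t + B(t), that is, B(t) = t e^t / (e^t - 1).
conv-one-B : ∀ m → conv one B m ≡ ι m +ℚ B m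
conv-one-B m = trans (conv-comm one B m) (trans (conv-∑ B one m) (trans
  (∑-cong (suc m) λ j _ → cong (ι (m C j) *ℚ_) (ℚ.*-identityʳ (B j))) (sumTo m)))
  where
  sumTo : ∀ m → ∑ (suc m) (λ j → ι (m C j) *ℚ B j) ≡ ι m +ℚ B m
  sumTo zero    = trans (ℚ.+-identityʳ _) (trans (cong (_*ℚ B 0) ι-1) (trans (ℚ.*-identityˡ (B 0)) (sym (trans (cong (_+ℚ B 0) ι-0) (ℚ.+-identityˡ (B 0))))))
  sumTo (suc t) = trans (∑-last (suc t) (λ j → ι (suc t C j) *ℚ B j)) (cong₂ _+ℚ_ (∑-C*B t) (trans (cong (_*ℚ B (suc t)) (trans (cong ι (nCn≡1 (suc t))) ι-1)) (ℚ.*-identityˡ _)))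

pow≡ : ∀ x n → pow (ι x) n ≡ ι (x ^ n)
pow≡ x zero    = sym ι-1
pow≡ x (suc n) = trans (cong (ι x *ℚ_) (pow≡ x n)) (sym (ι-* x (x ^ n)))

-- The left-hand side is the value at x of the Bernoulli polynomial of degree 1 + n.
conv-pow-B : ∀ n x → conv (pow (ι x)) B (suc n) ≡ ι (suc n) *ℚ ι (powerSum n x) +ℚ B (suc n)
conv-pow-B n zero = begin
  conv (pow (ι 0)) B (suc n)      ≡⟨ cong (λ z → conv (pow z) B (suc n)) ι-0 ⟩
  conv (pow 0ℚ) B (suc n)         ≡⟨ conv-pow-0 B (suc n) ⟩
  B (suc n)                       ≡⟨ ℚ.+-identityˡ (B (suc n)) ⟨
  0ℚ +ℚ B (suc n)                 ≡⟨ cong (_+ℚ B (suc n)) (trans (cong (ι (suc n) *ℚ_) ι-0) (ℚ.*-zeroʳ (ι (suc n)))) ⟨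
  ι (suc n) *ℚ ι 0 +ℚ B (suc n)   ∎
  where
  open ≡-Reasoning
  conv-pow-0 : ∀ b n → conv (pow 0ℚ) b n ≡ b n
  conv-pow-0 b zero    = ℚ.*-identityˡ (b 0)
  conv-pow-0 b (suc n) = trans
    (cong₂ _+ℚ_ (trans (conv-cong n (λ i → ℚ.*-zeroˡ (pow 0ℚ i)) (λ _ → refl)) (conv-zeroˡ b n)) (conv-pow-0 (b ∘ suc) n))
    (ℚ.+-identityˡ _)
-- Passing to x + 1 multiplies e^(xt) B(t) by e^t, which by `conv-one-B` adds t e^((x+1)t). The
-- value therefore grows by (n+1)(x+1)^n.
conv-pow-B n (suc x) = begin
  conv (pow (ι (suc x))) B (suc n)
    ≡⟨ cong (λ y → conv (pow y) B (suc n)) 1+x ⟩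
  conv (pow (ι x +ℚ 1ℚ)) B (suc n)
    ≡⟨ conv-cong (suc n) (conv-pow-one (ι x)) (λ _ → refl) ⟨
  conv (conv (pow (ι x)) one) B (suc n)
    ≡⟨ conv-assoc (pow (ι x)) one B (suc n) ⟩
  conv (pow (ι x)) (conv one B) (suc n)
    ≡⟨ conv-cong (suc n) (λ _ → refl) conv-one-B ⟩
  conv (pow (ι x)) (λ i → ι i +ℚ B i) (suc n)
    ≡⟨ conv-+ʳ (pow (ι x)) ι B (suc n) ⟩
  conv (pow (ι x)) ι (suc n) +ℚ conv (pow (ι x)) B (suc n)
    ≡⟨ cong₂ _+ℚ_ (trans (conv-pow-ι (ι x) n) (cong (N *ℚ_) (trans (cong (λ y → pow y n) (sym 1+x)) (pow≡ (suc x) n)))) (conv-pow-B n x) ⟩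
  N *ℚ ι (suc x ^ n) +ℚ (N *ℚ ι (powerSum n x) +ℚ B (suc n))
    ≡⟨ solve 4 (λ N a b c → N :* a :+ (N :* b :+ c) := N :* (b :+ a) :+ c) refl N (ι (suc x ^ n)) (ι (powerSum n x)) (B (suc n)) ⟩
  N *ℚ (ι (powerSum n x) +ℚ ι (suc x ^ n)) +ℚ B (suc n)
    ≡⟨ cong (λ y → N *ℚ y +ℚ B (suc n)) (ι-+ (powerSum n x) (suc x ^ n)) ⟨
  N *ℚ ι (powerSum n (suc x)) +ℚ B (suc n) ∎
  where
  open ≡-Reasoning
  N : ℚ
  N = ι (suc n)
  1+x : ι (suc x) ≡ ι x +ℚ 1ℚ
  1+x = trans (cong ι (+-comm 1 x)) (trans (ι-+ x 1) (cong (ι x +ℚ_) ι-1))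

-- The term with x^0 in `conv-pow-B` is `B (suc n)` and cancels, so no constant term remains.
faulhaber : ∀ n x → ∑ (suc n) (λ j → ι (suc n C suc j) *ℚ (ι (x ^ suc j) *ℚ B (n ∸ j))) ≡ ι (suc n) *ℚ ι (powerSum n x)
faulhaber n x = +ℚ-cancelˡ (B (suc n)) _ _ (begin
  B (suc n) +ℚ ∑ (suc n) (λ j → ι (suc n C suc j) *ℚ (ι (x ^ suc j) *ℚ B (n ∸ j)))
    ≡⟨ cong₂ _+ℚ_ (trans (cong (_*ℚ (1ℚ *ℚ B (suc n))) ι-1) (trans (ℚ.*-identityˡ _) (ℚ.*-identityˡ (B (suc n))))) (∑-cong (suc n) λ j _ → cong (λ y → ι (suc n C suc j) *ℚ (y *ℚ B (n ∸ j))) (pow≡ x (suc j))) ⟨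
  ∑ (2 + n) (λ j → ι (suc n C j) *ℚ (pow (ι x) j *ℚ B (suc n ∸ j)))
    ≡⟨ conv-∑ (pow (ι x)) B (suc n) ⟨
  conv (pow (ι x)) B (suc n)
    ≡⟨ conv-pow-B n x ⟩
  ι (suc n) *ℚ ι (powerSum n x) +ℚ B (suc n)
    ≡⟨ ℚ.+-comm _ (B (suc n)) ⟩
  B (suc n) +ℚ ι (suc n) *ℚ ι (powerSum n x) ∎)
  where open ≡-Reasoning

-- The von Staudt–Clausen theorem

-- Membership in the localisation of ℤ at p: a = (x - y) / m with p ∤ m.
Loc : ℕ → ℚ → Set
Loc p a = ∃[ m ] ∃[ x ] ∃[ y ] (¬ p ∣ m × ι m *ℚ a +ℚ ι y ≡ ι x)

-- The ideal generated by p in this localisation, used for congruences modulo p between p-integral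
-- numbers.
Div : ℕ → ℚ → Set
Div p a = ∃[ w ] (Loc p w × a ≡ ι p *ℚ w)

module _ {p : ℕ} (pr : Prime p) where

  Loc-ι : ∀ n → Loc p (ι n)
  Loc-ι n = 1 , n , 0 , prime∤1 pr , (begin
    ι 1 *ℚ ι n +ℚ ι 0 ≡⟨ cong₂ (λ u z → u *ℚ ι n +ℚ z) ι-1 ι-0 ⟩
    1ℚ *ℚ ι n +ℚ 0ℚ   ≡⟨ solve 1 (λ x → con 1ℚ :* x :+ con 0ℚ := x) refl (ι n) ⟩
    ι n               ∎)
    where open ≡-Reasoning

  Loc-+ : ∀ {a b} → Loc p a → Loc p b → Loc p (a +ℚ b)
  Loc-+ {a} {b} (m , x , y , p∤m , eq) (m′ , x′ , y′ , p∤m′ , eq′) =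
    m * m′ , m′ * x + m * x′ , m′ * y + m * y′ , prime∤* pr p∤m p∤m′ , (begin
    ι (m * m′) *ℚ (a +ℚ b) +ℚ ι (m′ * y + m * y′)
      ≡⟨ cong₂ (λ u v → u *ℚ (a +ℚ b) +ℚ v) (ι-* m m′) (lin y y′) ⟩
    ι m *ℚ ι m′ *ℚ (a +ℚ b) +ℚ (ι m′ *ℚ ι y +ℚ ι m *ℚ ι y′)
      ≡⟨ solve 6 (λ m m′ a b y y′ → m :* m′ :* (a :+ b) :+ (m′ :* y :+ m :* y′) := m′ :* (m :* a :+ y) :+ m :* (m′ :* b :+ y′)) refl (ι m) (ι m′) a b (ι y) (ι y′) ⟩
    ι m′ *ℚ (ι m *ℚ a +ℚ ι y) +ℚ ι m *ℚ (ι m′ *ℚ b +ℚ ι y′)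
      ≡⟨ cong₂ (λ u v → ι m′ *ℚ u +ℚ ι m *ℚ v) eq eq′ ⟩
    ι m′ *ℚ ι x +ℚ ι m *ℚ ι x′
      ≡⟨ lin x x′ ⟨
    ι (m′ * x + m * x′) ∎)
    where
    open ≡-Reasoning
    lin : ∀ x x′ → ι (m′ * x + m * x′) ≡ ι m′ *ℚ ι x +ℚ ι m *ℚ ι x′
    lin x x′ = trans (ι-+ _ _) (cong₂ _+ℚ_ (ι-* m′ x) (ι-* m x′))

  Loc-* : ∀ {a b} → Loc p a → Loc p b → Loc p (a *ℚ b)
  Loc-* {a} {b} (m , x , y , p∤m , eq) (m′ , x′ , y′ , p∤m′ , eq′) =
    m * m′ , x * x′ + y * y′ , x * y′ + y * x′ , prime∤* pr p∤m p∤m′ , (begin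
    ι (m * m′) *ℚ (a *ℚ b) +ℚ ι (x * y′ + y * x′)
      ≡⟨ cong₂ (λ u v → u *ℚ (a *ℚ b) +ℚ v) (ι-* m m′) (bil x y′ y x′) ⟩
    ι m *ℚ ι m′ *ℚ (a *ℚ b) +ℚ (ι x *ℚ ι y′ +ℚ ι y *ℚ ι x′)
      ≡⟨ cong₂ (λ u v → ι m *ℚ ι m′ *ℚ (a *ℚ b) +ℚ (u *ℚ ι y′ +ℚ ι y *ℚ v)) eq eq′ ⟨
    ι m *ℚ ι m′ *ℚ (a *ℚ b) +ℚ ((ι m *ℚ a +ℚ ι y) *ℚ ι y′ +ℚ ι y *ℚ (ι m′ *ℚ b +ℚ ι y′))
      ≡⟨ solve 6 (λ m m′ a b y y′ → m :* m′ :* (a :* b) :+ ((m :* a :+ y) :* y′ :+ y :* (m′ :* b :+ y′)) := (m :* a :+ y) :* (m′ :* b :+ y′) :+ y :* y′) refl (ι m) (ι m′) a b (ι y) (ι y′) ⟩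
    (ι m *ℚ a +ℚ ι y) *ℚ (ι m′ *ℚ b +ℚ ι y′) +ℚ ι y *ℚ ι y′
      ≡⟨ cong₂ (λ u v → u *ℚ v +ℚ ι y *ℚ ι y′) eq eq′ ⟩
    ι x *ℚ ι x′ +ℚ ι y *ℚ ι y′
      ≡⟨ bil x x′ y y′ ⟨
    ι (x * x′ + y * y′) ∎)
    where
    open ≡-Reasoning
    bil : ∀ a b c d → ι (a * b + c * d) ≡ ι a *ℚ ι b +ℚ ι c *ℚ ι d
    bil a b c d = trans (ι-+ _ _) (cong₂ _+ℚ_ (ι-* a b) (ι-* c d))

  Loc-neg : ∀ {a} → Loc p a → Loc p (-ℚ a)
  Loc-neg {a} (m , x , y , p∤m , eq) = m , y , x , p∤m , (begin
    ι m *ℚ (-ℚ a) +ℚ ι x                  ≡⟨ cong (ι m *ℚ (-ℚ a) +ℚ_) eq ⟨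
    ι m *ℚ (-ℚ a) +ℚ (ι m *ℚ a +ℚ ι y)    ≡⟨ solve 3 (λ m a y → m :* (:- a) :+ (m :* a :+ y) := y) refl (ι m) a (ι y) ⟩
    ι y                                   ∎)
    where open ≡-Reasoning

  Loc-recip : ∀ {k} → ¬ p ∣ suc k → Loc p (recip k)
  Loc-recip {k} p∤1+k = suc k , 1 , 0 , p∤1+k , (begin
    ι (suc k) *ℚ recip k +ℚ ι 0   ≡⟨ cong₂ _+ℚ_ (*-recip k) ι-0 ⟩
    1ℚ +ℚ 0ℚ                      ≡⟨ ι-1 ⟨
    ι 1                           ∎)
    where open ≡-Reasoning

  Div⇒Loc : ∀ {a} → Div p a → Loc p a
  Div⇒Loc (w , lw , refl) = Loc-* (Loc-ι p) lw

  Div-+ : ∀ {a b} → Div p a → Div p b → Div p (a +ℚ b)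
  Div-+ (w , lw , refl) (w′ , lw′ , refl) = w +ℚ w′ , Loc-+ lw lw′ , sym (ℚ.*-distribˡ-+ (ι p) w w′)

  Div-neg : ∀ {a} → Div p a → Div p (-ℚ a)
  Div-neg (w , lw , refl) = -ℚ w , Loc-neg lw , ℚ.neg-distribʳ-* (ι p) w

  Div-*ˡ : ∀ {a b} → Loc p a → Div p b → Div p (a *ℚ b)
  Div-*ˡ {a} la (w , lw , refl) = a *ℚ w , Loc-* la lw , solve 3 (λ a q w → a :* (q :* w) := q :* (a :* w)) refl a (ι p) w

  Div-ι : ∀ {n} → p ∣ n → Div p (ι n)
  Div-ι (divides q refl) = ι q , Loc-ι q , trans (ι-* q p) (ℚ.*-comm (ι q) (ι p))

  Div-ι⁻¹ : ∀ {n} → Div p (ι n) → p ∣ n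
  Div-ι⁻¹ {n} (w , (m , x , y , p∤m , eq) , ιn≡pw) = prime∣*∤⇒∣ pr m n
    (∣m+n∣m⇒∣n (subst (p ∣_) (sym (trans (+-comm (p * y) (m * n)) mn+py≡px)) (m∣m*n x)) (m∣m*n y)) p∤m
    where
    open ≡-Reasoning
    mn+py≡px : m * n + p * y ≡ p * x
    mn+py≡px = ι-injective (begin
      ι (m * n + p * y)                  ≡⟨ trans (ι-+ _ _) (cong₂ _+ℚ_ (ι-* m n) (ι-* p y)) ⟩
      ι m *ℚ ι n +ℚ ι p *ℚ ι y           ≡⟨ cong (λ z → ι m *ℚ z +ℚ ι p *ℚ ι y) ιn≡pw ⟩
      ι m *ℚ (ι p *ℚ w) +ℚ ι p *ℚ ι y    ≡⟨ solve 4 (λ m q w y → m :* (q :* w) :+ q :* y := q :* (m :* w :+ y)) refl (ι m) (ι p) w (ι y) ⟩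
      ι p *ℚ (ι m *ℚ w +ℚ ι y)           ≡⟨ cong (ι p *ℚ_) eq ⟩
      ι p *ℚ ι x                         ≡⟨ ι-* p x ⟨
      ι (p * x)                          ∎)

  Div-∑ : ∀ n {f} → (∀ i → i < n → Div p (f i)) → Div p (∑ n f)
  Div-∑ zero    df = subst (Div p) ι-0 (Div-ι (p ∣0))
  Div-∑ (suc n) df = Div-+ (df 0 z<s) (Div-∑ n (λ i i<n → df (suc i) (s<s i<n)))

  Div-p*⇒Loc : ∀ {a} → Div p (ι p *ℚ a) → Loc p a
  Div-p*⇒Loc {a} (w , lw , eq) = subst (Loc p) (sym (ι-cancelˡ (pred p) (subst (λ q → ι q *ℚ a ≡ ι q *ℚ w) (sym (suc-pred p {{prime⇒nonZero pr}})) eq))) lw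

  2+v≤p^v : ∀ v → 2 ≤ v → 2 + v ≤ p ^ v
  2+v≤p^v (suc zero) (s≤s ())
  2+v≤p^v (suc (suc zero)) _ = *-mono-≤ 1<p (subst (2 ≤_) (sym (*-identityʳ p)) 1<p)
    where
    1<p : 1 < p
    1<p = nonTrivial⇒n>1 p {{prime⇒nonTrivial pr}}
  2+v≤p^v (suc v@(suc (suc _))) _ = begin
    3 + v           ≤⟨ +-monoˡ-≤ (2 + v) (s≤s (z≤n {1 + v})) ⟩
    2 + v + (2 + v) ≡⟨ cong (2 + v +_) (+-identityʳ (2 + v)) ⟨
    2 * (2 + v)     ≤⟨ *-mono-≤ (nonTrivial⇒n>1 p {{prime⇒nonTrivial pr}}) (2+v≤p^v v (s≤s (s≤s z≤n))) ⟩
    p * p ^ v       ∎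
    where open ≤-Reasoning

  -- i + 1 is divisible by p at most i - 1 times.
  Div-p^i/[1+i] : ∀ i → 1 ≤ i → 3 ≤ p ⊎ 2 ≤ i → Div p (recip i *ℚ ι (p ^ i))
  Div-p^i/[1+i] i 1≤i h with valuation pr (suc i) z<s
  ... | v , zero  , _   , p∤0 = contradiction (p ∣0) p∤0
  ... | v , suc m , 1+i≡ , p∤m = ι (p ^ e) *ℚ recip m , Loc-* (Loc-ι (p ^ e)) (Loc-recip p∤m) , (begin
    recip i *ℚ ι (p ^ i)
      ≡⟨ cong (recip i *ℚ_) (trans (cong ι p^i≡) (trans (ι-* (p ^ v) (p * p ^ e)) (cong (ι (p ^ v) *ℚ_) (ι-* p (p ^ e))))) ⟩
    recip i *ℚ (ι (p ^ v) *ℚ (ι p *ℚ ι (p ^ e)))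
      ≡⟨ ℚ.*-identityʳ _ ⟨
    recip i *ℚ (ι (p ^ v) *ℚ (ι p *ℚ ι (p ^ e))) *ℚ 1ℚ
      ≡⟨ cong (recip i *ℚ (ι (p ^ v) *ℚ (ι p *ℚ ι (p ^ e))) *ℚ_) (*-recip m) ⟨
    recip i *ℚ (ι (p ^ v) *ℚ (ι p *ℚ ι (p ^ e))) *ℚ (ι (suc m) *ℚ recip m)
      ≡⟨ solve 6 (λ r a q b c s → r :* (a :* (q :* b)) :* (c :* s) := (a :* c) :* r :* (q :* (b :* s))) refl (recip i) (ι (p ^ v)) (ι p) (ι (p ^ e)) (ι (suc m)) (recip m) ⟩
    ι (p ^ v) *ℚ ι (suc m) *ℚ recip i *ℚ (ι p *ℚ (ι (p ^ e) *ℚ recip m))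
      ≡⟨ cong (λ z → z *ℚ recip i *ℚ (ι p *ℚ (ι (p ^ e) *ℚ recip m))) (trans (sym (ι-* (p ^ v) (suc m))) (cong ι (sym 1+i≡))) ⟩
    ι (suc i) *ℚ recip i *ℚ (ι p *ℚ (ι (p ^ e) *ℚ recip m))
      ≡⟨ cong (_*ℚ (ι p *ℚ (ι (p ^ e) *ℚ recip m))) (*-recip i) ⟩
    1ℚ *ℚ (ι p *ℚ (ι (p ^ e) *ℚ recip m))
      ≡⟨ ℚ.*-identityˡ _ ⟩
    ι p *ℚ (ι (p ^ e) *ℚ recip m) ∎)
    where
    open ≡-Reasoning
    p^v≤1+i : p ^ v ≤ suc i
    p^v≤1+i = subst (p ^ v ≤_) (sym 1+i≡) (m≤m*n (p ^ v) (suc m))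
    v<i′ : ∀ v → p ^ v ≤ suc i → v < i
    v<i′ zero          _     = 1≤i
    -- Here p = 2 with i = 1 has to be excluded, since 2^1/2 = 1 is a unit.
    v<i′ (suc zero)    p≤1+i = [ (λ 3≤p → s≤s⁻¹ (≤-trans 3≤p (subst (_≤ suc i) (*-identityʳ p) p≤1+i))) , id ]′ h
    v<i′ v@(suc (suc _)) p^v≤ = s≤s⁻¹ (≤-trans (2+v≤p^v v (s≤s (s≤s z≤n))) p^v≤)
    v<i : v < i
    v<i = v<i′ v p^v≤1+i
    e : ℕ
    e = i ∸ suc v
    p^i≡ : p ^ i ≡ p ^ v * (p * p ^ e)
    p^i≡ = trans (cong (p ^_) (trans (sym (m+[n∸m]≡n v<i)) (sym (+-suc v e)))) (^-distribˡ-+-* p v (suc e))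

∸-suc-< : ∀ {i k} → i < k → k ∸ suc i < k
∸-suc-< {i} {k} i<k = ∸-monoʳ-< {k} {suc i} {0} z<s i<k

-- Since C(k+1, i+1)/(k+1) = C(k, i)/(i+1), dividing Faulhaber's formula by k + 1 leaves the
-- denominator i + 1, to be balanced against p^i at x = p.
faulhaberTerm : ℕ → ℕ → ℕ → ℚ
faulhaberTerm x k i = ι (k C i) *ℚ (recip i *ℚ (ι (x ^ suc i) *ℚ B (k ∸ i)))

faulhaber′ : ∀ k x → ∑ (suc k) (faulhaberTerm x k) ≡ ι (powerSum k x)
faulhaber′ k x = ι-cancelˡ k (trans (sym (∑-* (suc k) (ι (suc k)) (faulhaberTerm x k))) (trans (∑-cong (suc k) λ i _ → term i (ι (x ^ suc i) *ℚ B (k ∸ i))) (faulhaber k x)))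
  where
  open ≡-Reasoning
  term : ∀ i b → ι (suc k) *ℚ (ι (k C i) *ℚ (recip i *ℚ b)) ≡ ι (suc k C suc i) *ℚ b
  term i b = begin
    ι (suc k) *ℚ (ι (k C i) *ℚ (recip i *ℚ b))
      ≡⟨ solve 4 (λ k c r b → k :* (c :* (r :* b)) := k :* c :* (r :* b)) refl (ι (suc k)) (ι (k C i)) (recip i) b ⟩
    ι (suc k) *ℚ ι (k C i) *ℚ (recip i *ℚ b)
      ≡⟨ cong (_*ℚ (recip i *ℚ b)) (trans (sym (ι-* (suc k) (k C i))) (trans (cong ι (sym ([1+k]*C≡[1+n]*C k i))) (ι-* (suc i) (suc k C suc i)))) ⟩
    ι (suc i) *ℚ ι (suc k C suc i) *ℚ (recip i *ℚ b)
      ≡⟨ solve 4 (λ i c r b → i :* c :* (r :* b) := i :* r :* (c :* b)) refl (ι (suc i)) (ι (suc k C suc i)) (recip i) b ⟩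
    ι (suc i) *ℚ recip i *ℚ (ι (suc k C suc i) *ℚ b)
      ≡⟨ cong (_*ℚ (ι (suc k C suc i) *ℚ b)) (*-recip i) ⟩
    1ℚ *ℚ (ι (suc k C suc i) *ℚ b)
      ≡⟨ ℚ.*-identityˡ _ ⟩
    ι (suc k C suc i) *ℚ b ∎

recip-0 : recip 0 ≡ 1ℚ
recip-0 = trans (sym (ℚ.*-identityˡ (recip 0))) (trans (cong (_*ℚ recip 0) (sym ι-1)) (*-recip 0))

B-0 : B 0 ≡ ι 1
B-0 = trans (sym (ℚ.*-identityˡ (B 0))) (trans (cong (_*ℚ B 0) (sym ι-1)) (trans (sym (ℚ.+-identityʳ _)) (∑-C*B 0)))

module _ {p : ℕ} (pr : Prime p) where

  private
    T : ℕ → ℕ → ℚ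
    T = faulhaberTerm p

  term-0 : ∀ k → T k 0 ≡ ι p *ℚ B k
  term-0 k = begin
    ι 1 *ℚ (recip 0 *ℚ (ι (p ^ 1) *ℚ B k)) ≡⟨ cong₂ (λ a b → a *ℚ (b *ℚ (ι (p ^ 1) *ℚ B k))) ι-1 recip-0 ⟩
    1ℚ *ℚ (1ℚ *ℚ (ι (p ^ 1) *ℚ B k))       ≡⟨ trans (ℚ.*-identityˡ _) (ℚ.*-identityˡ (ι (p ^ 1) *ℚ B k)) ⟩
    ι (p ^ 1) *ℚ B k                       ≡⟨ cong (λ q → ι q *ℚ B k) (*-identityʳ p) ⟩
    ι p *ℚ B k                             ∎
    where open ≡-Reasoning

  -- Of the i + 1 factors p, one makes B_(k-i) p-integral and the others compensate i + 1.
  term-regroup : ∀ k i → T k i ≡ ι (k C i) *ℚ (ι p *ℚ B (k ∸ i)) *ℚ (recip i *ℚ ι (p ^ i))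
  term-regroup k i = trans (cong (λ z → ι (k C i) *ℚ (recip i *ℚ (z *ℚ B (k ∸ i)))) (ι-* p (p ^ i)))
    (solve 5 (λ c r q x b → c :* (r :* (q :* x :* b)) := c :* (q :* b) :* (r :* x)) refl (ι (k C i)) (recip i) (ι p) (ι (p ^ i)) (B (k ∸ i)))

  Div-term : ∀ k i → Loc p (ι p *ℚ B (k ∸ i)) → 1 ≤ i → 3 ≤ p ⊎ 2 ≤ i → Div p (T k i)
  Div-term k i l 1≤i h = subst (Div p) (sym (term-regroup k i)) (Div-*ˡ pr (Loc-* pr (Loc-ι pr (k C i)) l) (Div-p^i/[1+i] pr i 1≤i h))

  pB≡ : ∀ k s → T k 0 +ℚ s ≡ ι (powerSum k p) → ι p *ℚ B k ≡ ι (powerSum k p) +ℚ (-ℚ s)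
  pB≡ k s eq = trans (sym (term-0 k)) (trans (solve 2 (λ t s → t := t :+ s :+ (:- s)) refl (T k 0) s) (cong (_+ℚ (-ℚ s)) eq))

  -- Multiplying by c gives u c = p (c B_k) - c r, a multiple of p in the localisation, while p does
  -- not divide u. The conclusion says that p occurs in the denominator of B_k.
  pole : ∀ {k u r} → ι p *ℚ B k ≡ ι u +ℚ r → Div p r → ¬ p ∣ u → ∀ c → Loc p (ι c *ℚ B k) → p ∣ c
  pole {k} {u} {r} eq dr p∤u c l = prime∣*∤⇒∣ pr u c (Div-ι⁻¹ pr (subst (Div p) (sym uc≡)
      (Div-+ pr (ι c *ℚ B k , l , refl) (Div-neg pr (Div-*ˡ pr (Loc-ι pr c) dr))))) p∤u
    where
    open ≡-Reasoning
    uc≡ : ι (u * c) ≡ ι p *ℚ (ι c *ℚ B k) +ℚ (-ℚ (ι c *ℚ r))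
    uc≡ = begin
      ι (u * c)                                     ≡⟨ ι-* u c ⟩
      ι u *ℚ ι c                                    ≡⟨ solve 3 (λ u c r → u :* c := c :* (u :+ r) :+ (:- (c :* r))) refl (ι u) (ι c) r ⟩
      ι c *ℚ (ι u +ℚ r) +ℚ (-ℚ (ι c *ℚ r))          ≡⟨ cong (λ z → ι c *ℚ z +ℚ (-ℚ (ι c *ℚ r))) eq ⟨
      ι c *ℚ (ι p *ℚ B k) +ℚ (-ℚ (ι c *ℚ r))        ≡⟨ cong (_+ℚ (-ℚ (ι c *ℚ r))) (solve 3 (λ c q b → c :* (q :* b) := q :* (c :* b)) refl (ι c) (ι p) (B k)) ⟩
      ι p *ℚ (ι c *ℚ B k) +ℚ (-ℚ (ι c *ℚ r))        ∎

  module OddPrime (3≤p : 3 ≤ p) where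

    private
      tail : ℕ → ℚ
      tail k = ∑ k (T k ∘ suc)

      Div-tail : ∀ k → (∀ {j} → j < k → Loc p (ι p *ℚ B j)) → Div p (tail k)
      Div-tail k ih = Div-∑ pr k λ i i<k → Div-term k (suc i) (ih (∸-suc-< i<k)) (s≤s z≤n) (inj₁ 3≤p)

    -- Faulhaber's formula at x = p isolates p B_k, and the other terms involve only p B_j with j <
    -- k.
    Loc-p*B : ∀ k → Loc p (ι p *ℚ B k)
    Loc-p*B = <-rec _ λ k ih → subst (Loc p) (sym (pB≡ k (tail k) (faulhaber′ k p)))
      (Loc-+ pr (Loc-ι pr _) (Loc-neg pr (Div⇒Loc pr (Div-tail k ih))))

    p*B≡powerSum : ∀ k → ∃[ r ] (Div p r × ι p *ℚ B k ≡ ι (powerSum k p) +ℚ r)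
    p*B≡powerSum k = -ℚ tail k , Div-neg pr (Div-tail k (λ {j} _ → Loc-p*B j)) , pB≡ k (tail k) (faulhaber′ k p)

    Loc-B : ∀ k → ¬ pred p ∣ k → Loc p (B k)
    Loc-B k p-1∤k = let r , dr , eq = p*B≡powerSum k in Div-p*⇒Loc pr (subst (Div p) (sym eq) (Div-+ pr (Div-ι pr (∤⇒p∣powerSum pr k p-1∤k)) dr))

    p∣-of-Loc-B : ∀ k → 0 < k → pred p ∣ k → ∀ c → Loc p (ι c *ℚ B k) → p ∣ c
    p∣-of-Loc-B k 0<k p-1∣k = let r , dr , eq = p*B≡powerSum k in pole eq dr (∣⇒p∤powerSum pr k 0<k p-1∣k)

-- The prime 2

module PrimeTwo where

  private
    pr : Prime 2
    pr = prime[2]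

    T : ℕ → ℕ → ℚ
    T = faulhaberTerm 2

    tail : ℕ → ℚ
    tail k = ∑ k (λ i → T (suc k) (2 + i))

    recip-1*2 : recip 1 *ℚ ι 2 ≡ 1ℚ
    recip-1*2 = trans (ℚ.*-comm (recip 1) (ι 2)) (*-recip 1)

    -- Since 2^1/2 = 1, this term is 2-integral but need not be even; it is kept out of `tail`,
    -- which starts at i = 2.
    T-1 : ∀ k → T (suc k) 1 ≡ ι (suc k) *ℚ (ι 2 *ℚ B k)
    T-1 k = begin
      ι (suc k C 1) *ℚ (recip 1 *ℚ (ι 4 *ℚ B k))
        ≡⟨ cong₂ (λ c z → ι c *ℚ (recip 1 *ℚ (z *ℚ B k))) (nC1≡n (suc k)) (ι-* 2 2) ⟩
      ι (suc k) *ℚ (recip 1 *ℚ (ι 2 *ℚ ι 2 *ℚ B k))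
        ≡⟨ solve 4 (λ n r t b → n :* (r :* (t :* t :* b)) := n :* (r :* t :* (t :* b))) refl (ι (suc k)) (recip 1) (ι 2) (B k) ⟩
      ι (suc k) *ℚ (recip 1 *ℚ ι 2 *ℚ (ι 2 *ℚ B k))
        ≡⟨ cong (λ z → ι (suc k) *ℚ (z *ℚ (ι 2 *ℚ B k))) recip-1*2 ⟩
      ι (suc k) *ℚ (1ℚ *ℚ (ι 2 *ℚ B k))
        ≡⟨ cong (ι (suc k) *ℚ_) (ℚ.*-identityˡ (ι 2 *ℚ B k)) ⟩
      ι (suc k) *ℚ (ι 2 *ℚ B k) ∎
      where open ≡-Reasoning

    2B≡ : ∀ k → ι 2 *ℚ B (suc k) ≡ ι (powerSum (suc k) 2) +ℚ (-ℚ (ι (suc k) *ℚ (ι 2 *ℚ B k) +ℚ tail k))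
    2B≡ k = pB≡ pr (suc k) (ι (suc k) *ℚ (ι 2 *ℚ B k) +ℚ tail k)
      (trans (cong (λ z → T (suc k) 0 +ℚ (z +ℚ tail k)) (sym (T-1 k))) (faulhaber′ (suc k) 2))

    Div-tail : ∀ k → (∀ {j} → j < suc k → Loc 2 (ι 2 *ℚ B j)) → Div 2 (tail k)
    Div-tail k ih = Div-∑ pr k λ i i<k → Div-term pr (suc k) (2 + i) (ih (<-trans (∸-suc-< i<k) (n<1+n k))) (s≤s z≤n) (inj₂ (s≤s (s≤s z≤n)))

    2B-0 : ι 2 *ℚ B 0 ≡ ι 2
    2B-0 = trans (cong (ι 2 *ℚ_) B-0) (sym (ι-* 2 1))

  Loc-2*B : ∀ k → Loc 2 (ι 2 *ℚ B k)
  Loc-2*B = <-rec _ λ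
    { zero    _  → subst (Loc 2) (sym 2B-0) (Loc-ι pr 2)
    ; (suc k) ih → subst (Loc 2) (sym (2B≡ k)) (Loc-+ pr (Loc-ι pr (powerSum (suc k) 2)) (Loc-neg pr
        (Loc-+ pr (Loc-* pr (Loc-ι pr (suc k)) (ih (n<1+n k))) (Div⇒Loc pr (Div-tail k ih))))) }

  private
    powerSum-2 : ∀ k → powerSum (suc k) 2 ≡ 1 + 2 ^ suc k
    powerSum-2 k = cong (_+ 2 ^ suc k) (^-zeroˡ (suc k))

    2∤powerSum : ∀ k → ¬ 2 ∣ powerSum (suc k) 2
    2∤powerSum k 2∣ = prime∤1 pr (∣m+n∣m⇒∣n (subst (2 ∣_) (trans (powerSum-2 k) (+-comm 1 (2 ^ suc k))) 2∣) (m∣m*n (2 ^ k)))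

    -- The hypothesis makes the exceptional term `T-1` even. It holds if k + 1 is even, and also for
    -- k = 0 because 2 B_0 = 2.
    2B-even : ∀ k → Div 2 (ι (suc k) *ℚ (ι 2 *ℚ B k)) → ∃[ r ] (Div 2 r × ι 2 *ℚ B (suc k) ≡ ι (powerSum (suc k) 2) +ℚ r)
    2B-even k d = _ , Div-neg pr (Div-+ pr d (Div-tail k (λ {j} _ → Loc-2*B j))) , 2B≡ k

    2B-at-even : ∀ k → 2 ∣ suc k → ∃[ r ] (Div 2 r × ι 2 *ℚ B (suc k) ≡ ι (powerSum (suc k) 2) +ℚ r)
    2B-at-even k (divides q 1+k≡q*2) = 2B-even k (subst (Div 2) (ℚ.*-comm (ι 2 *ℚ B k) (ι (suc k))) (Div-*ˡ pr (Loc-2*B k) (Div-ι pr (divides q 1+k≡q*2))))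

    2B-at-1 : ∃[ r ] (Div 2 r × ι 2 *ℚ B 1 ≡ ι (powerSum 1 2) +ℚ r)
    2B-at-1 = 2B-even 0 (subst (Div 2) (trans (ι-* 1 2) (cong (ι 1 *ℚ_) (sym 2B-0))) (Div-ι pr (∣-refl {2})))

  2∣-of-Loc-B : ∀ k → suc k ≡ 1 ⊎ 2 ∣ suc k → ∀ c → Loc 2 (ι c *ℚ B (suc k)) → 2 ∣ c
  2∣-of-Loc-B k (inj₂ 2∣) = let r , dr , eq = 2B-at-even k 2∣ in pole pr eq dr (2∤powerSum k)
  2∣-of-Loc-B zero (inj₁ _) = let r , dr , eq = 2B-at-1 in pole pr eq dr (2∤powerSum 0)

-- Coefficients of polynomial functions

-- Coefficients are compared as functions on ℕ, because lists that differ by trailing zeros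
-- represent the same polynomial.
coef : Poly → ℕ → ℚ
coef []      _       = 0ℚ
coef (a ∷ c) zero    = a
coef (a ∷ c) (suc i) = coef c i

-- Synthetic division by X - r.
quot : ℚ → Poly → Poly
quot r []            = []
quot r (a ∷ [])      = []
quot r (a ∷ c@(_ ∷ _)) = eval c r ∷ quot r c

length-quot : ∀ r a c → length (quot r (a ∷ c)) ≡ length c
length-quot r a []      = refl
length-quot r a (b ∷ c) = cong suc (length-quot r b c)

eval-quot : ∀ r x c → eval c x ≡ eval c r +ℚ (x -ℚ r) *ℚ eval (quot r c) x
eval-quot r x []            = sym (trans (ℚ.+-identityˡ _) (ℚ.*-zeroʳ (x -ℚ r)))
eval-quot r x (a ∷ [])      = solve 3 (λ a x r → a :+ x :* con 0ℚ := a :+ r :* con 0ℚ :+ (x :- r) :* con 0ℚ) refl a x r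
eval-quot r x (a ∷ c@(_ ∷ _)) = trans (cong (λ z → a +ℚ x *ℚ z) (eval-quot r x c))
  (solve 5 (λ a x r e q → a :+ x :* (e :+ (x :- r) :* q) := a :+ r :* e :+ (x :- r) :* (e :+ x :* q)) refl a x r (eval c r) (eval (quot r c) x))

-- The head of the quotient of a ∷ c is the value of c at r, so vanishing of the quotient supplies
-- the hypothesis for the tail.
coef-zero : ∀ r c → eval c r ≡ 0ℚ → (∀ i → coef (quot r c) i ≡ 0ℚ) → ∀ i → coef c i ≡ 0ℚ
coef-zero r []            c[r]≡0 q≡0 i       = refl
coef-zero r (a ∷ [])      c[r]≡0 q≡0 zero    = trans (sym (trans (cong (a +ℚ_) (ℚ.*-zeroʳ r)) (ℚ.+-identityʳ a))) c[r]≡0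
coef-zero r (a ∷ [])      c[r]≡0 q≡0 (suc i) = refl
coef-zero r (a ∷ c@(_ ∷ _)) c[r]≡0 q≡0 zero    = trans
  (sym (trans (cong (λ z → a +ℚ r *ℚ z) (q≡0 0)) (trans (cong (a +ℚ_) (ℚ.*-zeroʳ r)) (ℚ.+-identityʳ a)))) c[r]≡0
coef-zero r (a ∷ c@(_ ∷ _)) c[r]≡0 q≡0 (suc i) = coef-zero r c (q≡0 0) (q≡0 ∘ suc) i

-- Division by X - N shortens the list by one, and the quotient still vanishes at every x > N. The
-- threshold thus moves up with each root removed.
vanishing : ∀ l c → length c ≡ l → ∀ N → (∀ x → N ≤ x → eval c (ι x) ≡ 0ℚ) → ∀ i → coef c i ≡ 0ℚ
vanishing zero    []      _    N c≡0 i = refl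
vanishing (suc l) (a ∷ c) ∣c∣≡ N c≡0 = coef-zero (ι N) (a ∷ c) (c≡0 N ≤-refl)
  (vanishing l (quot (ι N) (a ∷ c)) (trans (length-quot (ι N) a c) (suc-injective ∣c∣≡)) (suc N) quotient≡0)
  where
  open ≡-Reasoning
  q : Poly
  q = quot (ι N) (a ∷ c)
  quotient≡0 : ∀ x → N < x → eval q (ι x) ≡ 0ℚ
  quotient≡0 x N<x = ι-cancelˡ k (begin
    ι (suc k) *ℚ eval q (ι x)                        ≡⟨ cong (_*ℚ eval q (ι x)) x-N ⟨
    (ι x -ℚ ι N) *ℚ eval q (ι x)                     ≡⟨ ℚ.+-identityˡ _ ⟨
    0ℚ +ℚ (ι x -ℚ ι N) *ℚ eval q (ι x)               ≡⟨ cong (_+ℚ (ι x -ℚ ι N) *ℚ eval q (ι x)) (c≡0 N ≤-refl) ⟨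
    eval (a ∷ c) (ι N) +ℚ (ι x -ℚ ι N) *ℚ eval q (ι x) ≡⟨ eval-quot (ι N) (ι x) (a ∷ c) ⟨
    eval (a ∷ c) (ι x)                               ≡⟨ c≡0 x (<⇒≤ N<x) ⟩
    0ℚ                                               ≡⟨ ℚ.*-zeroʳ (ι (suc k)) ⟨
    ι (suc k) *ℚ 0ℚ                                  ∎)
    where
    k : ℕ
    k = x ∸ suc N
    x-N : ι x -ℚ ι N ≡ ι (suc k)
    x-N = begin
      ι x -ℚ ι N                   ≡⟨ cong (λ y → ι y -ℚ ι N) (trans (sym (m+[n∸m]≡n N<x)) (sym (+-suc N k))) ⟩
      ι (N + suc k) -ℚ ι N         ≡⟨ cong (_-ℚ ι N) (ι-+ N (suc k)) ⟩
      ι N +ℚ ι (suc k) -ℚ ι N      ≡⟨ solve 2 (λ n k → n :+ k :- n := k) refl (ι N) (ι (suc k)) ⟩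
      ι (suc k)                    ∎

_⊖_ : Poly → Poly → Poly
c       ⊖ []      = c
[]      ⊖ (b ∷ e) = -ℚ b ∷ ([] ⊖ e)
(a ∷ c) ⊖ (b ∷ e) = (a -ℚ b) ∷ (c ⊖ e)

coef-⊖ : ∀ c e i → coef (c ⊖ e) i ≡ coef c i -ℚ coef e i
coef-⊖ c       []      i       = sym (ℚ.+-identityʳ (coef c i))
coef-⊖ []      (b ∷ e) zero    = sym (ℚ.+-identityˡ (-ℚ b))
coef-⊖ []      (b ∷ e) (suc i) = coef-⊖ [] e i
coef-⊖ (a ∷ c) (b ∷ e) zero    = refl
coef-⊖ (a ∷ c) (b ∷ e) (suc i) = coef-⊖ c e i

eval-⊖ : ∀ c e x → eval (c ⊖ e) x ≡ eval c x -ℚ eval e x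
eval-⊖ c       []      x = sym (ℚ.+-identityʳ (eval c x))
eval-⊖ []      (b ∷ e) x = trans (cong (λ z → -ℚ b +ℚ x *ℚ z) (eval-⊖ [] e x))
  (solve 3 (λ b x e → :- b :+ x :* (con 0ℚ :- e) := con 0ℚ :- (b :+ x :* e)) refl b x (eval e x))
eval-⊖ (a ∷ c) (b ∷ e) x = trans (cong (λ z → a -ℚ b +ℚ x *ℚ z) (eval-⊖ c e x))
  (solve 5 (λ a b x c e → a :- b :+ x :* (c :- e) := a :+ x :* c :- (b :+ x :* e)) refl a b x (eval c x) (eval e x))

coef-unique : ∀ c e → (∀ x → 1 ≤ x → eval c (ι x) ≡ eval e (ι x)) → ∀ i → coef c i ≡ coef e i
coef-unique c e c≡e i = begin
  coef c i                        ≡⟨ solve 2 (λ a b → a := a :- b :+ b) refl (coef c i) (coef e i) ⟩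
  coef c i -ℚ coef e i +ℚ coef e i ≡⟨ cong (_+ℚ coef e i) (coef-⊖ c e i) ⟨
  coef (c ⊖ e) i +ℚ coef e i      ≡⟨ cong (_+ℚ coef e i) (vanishing _ (c ⊖ e) refl 1 (λ x 1≤x →
                                       trans (eval-⊖ c e (ι x)) (trans (cong (_-ℚ eval e (ι x)) (c≡e x 1≤x)) (ℚ.+-inverseʳ (eval e (ι x))))) i) ⟩
  0ℚ +ℚ coef e i                  ≡⟨ ℚ.+-identityˡ (coef e i) ⟩
  coef e i                        ∎
  where open ≡-Reasoning

eval-applyUpTo : ∀ f n x → eval (applyUpTo f n) (ι x) ≡ ∑ n (λ i → ι (x ^ i) *ℚ f i)
eval-applyUpTo f zero    x = refl
eval-applyUpTo f (suc n) x = cong₂ _+ℚ_ (sym (trans (cong (_*ℚ f 0) ι-1) (ℚ.*-identityˡ (f 0)))) (begin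
  ι x *ℚ eval (applyUpTo (f ∘ suc) n) (ι x)        ≡⟨ cong (ι x *ℚ_) (eval-applyUpTo (f ∘ suc) n x) ⟩
  ι x *ℚ ∑ n (λ i → ι (x ^ i) *ℚ f (suc i))        ≡⟨ ∑-* n (ι x) (λ i → ι (x ^ i) *ℚ f (suc i)) ⟨
  ∑ n (λ i → ι x *ℚ (ι (x ^ i) *ℚ f (suc i)))      ≡⟨ ∑-cong n (λ i _ → trans (sym (ℚ.*-assoc (ι x) (ι (x ^ i)) (f (suc i)))) (cong (_*ℚ f (suc i)) (sym (ι-* x (x ^ i))))) ⟩
  ∑ n (λ i → ι (x ^ suc i) *ℚ f (suc i))           ∎)
  where open ≡-Reasoning

coef-applyUpTo : ∀ f {n} → (∀ i → n ≤ i → f i ≡ 0ℚ) → ∀ i → coef (applyUpTo f n) i ≡ f i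
coef-applyUpTo f {zero}  f≡0 i       = sym (f≡0 i z≤n)
coef-applyUpTo f {suc n} f≡0 zero    = refl
coef-applyUpTo f {suc n} f≡0 (suc i) = coef-applyUpTo (f ∘ suc) (λ i n≤i → f≡0 (suc i) (s≤s n≤i)) i

-- The digit argument

floorDiv-≤ : ∀ {n j} k → 0 < k → j ≤ floorDiv n k → j * k ≤ n
floorDiv-≤ {n} (suc k) _ j≤ = ≤-trans (*-monoˡ-≤ (suc k) j≤) (m/n*n≤m n (suc k))

≤-floorDiv : ∀ {n j} k → 0 < k → j * k ≤ n → j ≤ floorDiv n k
≤-floorDiv {n} {j} (suc k) _ jk≤n = subst (_≤ n / suc k) (m*n/n≡m j (suc k)) (/-monoˡ-≤ (suc k) jk≤n)

-- Positivity of j excludes k = 0, where the subtraction is truncated.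
j≤k∸1⇒j<k : ∀ {j k} → 0 < j → j ≤ k ∸ 1 → j < k
j≤k∸1⇒j<k {suc j} {suc k} _ j≤k = s≤s j≤k

-- With a = p - 1 it shows that the shift by p^(e+1) - 1 in `smaller-index` preserves multiples of p
-- - 1.
a∣a^n-1 : ∀ a n → a ∣ pred (suc a ^ n)
a∣a^n-1 a zero    = a ∣0
a∣a^n-1 a (suc n) with suc a ^ n | a∣a^n-1 a n | m^n≢0 (suc a) n
... | suc x | a∣x | _ = ∣m∣n⇒∣m+n a∣x (m∣m*n (suc x))

module _ {p : ℕ} (pr : Prime p) where

  private
    instance
      p≢0 : NonZero p
      p≢0 = prime⇒nonZero pr

  p∤bCi : ∀ b i → b < p → i ≤ b → ¬ p ∣ b C i
  p∤bCi b       zero    b<p i≤b p∣ = prime∤1 pr p∣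
  p∤bCi (suc b) (suc i) b<p i≤b p∣ =
    prime∤* pr (p∤1+k pr b<p) (p∤bCi b i (<-trans (n<1+n b) b<p) (s≤s⁻¹ i≤b))
      (subst (p ∣_) ([1+k]*C≡[1+n]*C b i) (∣n⇒∣m*n (suc i) p∣))

  p∤C⇒≤ : ∀ {a c} → ¬ p ∣ a C c → c ≤ a
  p∤C⇒≤ {a} {c} p∤ with c ≤? a
  ... | yes c≤a = c≤a
  ... | no  c≰a = contradiction (subst (p ∣_) (sym (k>n⇒nCk≡0 (≰⇒> c≰a))) (p ∣0)) p∤

  -- Moves a unit from a higher base-p digit of k to the lowest one: the digit sum is unchanged, so is k modulo p - 1.
  -- The position e + 1 of that digit is chosen so that p does not divide the binomial coefficient of the higher digits.
  smaller-index : ∀ {N k} → p ≤ k → k < N → N < k + p → ¬ p ∣ N C k →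
                  ∃[ k′ ] (0 < k′ × k′ < k × ¬ p ∣ N C k′ × ∃[ e ] (k ≡ k′ + pred (p ^ suc e)))
  smaller-index {N} {k} p≤k k<N N<k+p p∤NCk = digits (N / p) (k / p) (N % p) (k % p)
      (m≡m%n+[m/n]*n N p) (m≡m%n+[m/n]*n k p) (m%n<n N p) (m%n<n k p)
    where
    digits : ∀ a c b d → N ≡ b + a * p → k ≡ d + c * p → b < p → d < p →
             ∃[ k′ ] (0 < k′ × k′ < k × ¬ p ∣ N C k′ × ∃[ e ] (k ≡ k′ + pred (p ^ suc e)))
    -- By Lucas' theorem c ≤ a and d ≤ b. If c < a, then N would be at least k + p; hence the higher
    -- parts agree.
    digits a c b d N≡ k≡ b<p d<p with ≤-antisym (p∤C⇒≤ p∤aCc) (a≤c (p∤C⇒≤ p∤bCd))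
      where
      p∤product : ¬ p ∣ (a C c) * (b C d)
      p∤product p∣ = p∤NCk (subst₂ (λ s t → p ∣ s C t) (sym (trans N≡ (+-comm b (a * p)))) (sym (trans k≡ (+-comm d (c * p))))
        (mod-resp-∣ (mod-sym (lucas pr a c b<p d<p)) p∣))
      p∤aCc : ¬ p ∣ a C c
      p∤aCc p∣ = p∤product (∣m⇒∣m*n (b C d) p∣)
      p∤bCd : ¬ p ∣ b C d
      p∤bCd p∣ = p∤product (∣n⇒∣m*n (a C c) p∣)
      a≤c : d ≤ b → a ≤ c
      a≤c d≤b with a ≤? c
      ... | yes a≤c = a≤c
      ... | no  a≰c = contradiction (<-≤-trans N<k+p (begin
        k + p             ≡⟨ cong (_+ p) k≡ ⟩
        d + c * p + p     ≡⟨ trans (+-assoc d (c * p) p) (cong (d +_) (+-comm (c * p) p)) ⟩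
        d + suc c * p     ≤⟨ +-mono-≤ d≤b (*-monoˡ-≤ p (≰⇒> a≰c)) ⟩
        b + a * p         ≡⟨ N≡ ⟨
        N                 ∎)) (<-irrefl refl)
        where open ≤-Reasoning
    ... | refl with ∃[p^e]p∤aC[p^e] pr a 0<a
      where
      0<a : 0 < a
      0<a = n≢0⇒n>0 λ { refl → <⇒≱ d<p (subst (p ≤_) (trans k≡ (+-identityʳ d)) p≤k) }
    ... | e , q≤a , p∤aCq = k′ , subst (0 <_) (sym (+-suc ((a ∸ q) * p) d)) z<s , k′<k , p∤NCk′ , e , k≡k′+
      where
      q k′ : ℕ
      q  = p ^ e
      -- The higher part loses p^e, and C(a, a - p^e) = C(a, p^e) is not divisible by p. The lowest
      -- digit d + 1 is at most b because k < N.
      k′ = (a ∸ q) * p + suc d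
      d<b : d < b
      d<b = +-cancelʳ-< (a * p) d b (subst₂ _<_ k≡ N≡ k<N)
      p∤NCk′ : ¬ p ∣ N C k′
      p∤NCk′ p∣ = prime∤* pr (λ p∣aC → p∤aCq (subst (p ∣_) (sym (nCk≡nC[n∸k] q≤a)) p∣aC)) (p∤bCi b (suc d) b<p d<b)
        (mod-resp-∣ (lucas pr a (a ∸ q) b<p (≤-<-trans d<b b<p)) (subst (λ t → p ∣ t C k′) (trans N≡ (+-comm b (a * p))) p∣))
      instance
        pq≢0 : NonZero (p * q)
        pq≢0 = m^n≢0 p (suc e)
      k≡k′+ : k ≡ k′ + pred (p * q)
      k≡k′+ = begin
        k                                    ≡⟨ k≡ ⟩
        d + a * p                            ≡⟨ cong (λ t → d + t * p) (m∸n+n≡m q≤a) ⟨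
        d + (a ∸ q + q) * p                  ≡⟨ regroup d (a ∸ q) q p ⟩
        (a ∸ q) * p + (d + p * q)            ≡⟨ cong (λ t → (a ∸ q) * p + (d + t)) (suc-pred (p * q)) ⟨
        (a ∸ q) * p + (d + suc (pred (p * q))) ≡⟨ cong ((a ∸ q) * p +_) (+-suc d _) ⟩
        (a ∸ q) * p + (suc d + pred (p * q)) ≡⟨ +-assoc ((a ∸ q) * p) (suc d) _ ⟨
        k′ + pred (p * q)                    ∎
        where
        open ≡-Reasoning
        regroup : ∀ d x q p → d + (x + q) * p ≡ x * p + (d + p * q)
        regroup = solve-∀
      k′<k : k′ < k
      k′<k = subst (k′ <_) (sym k≡k′+) (m<m+n k′ (s<s⁻¹ (subst (1 <_) (sym (suc-pred (p * q)))
        (<-≤-trans (nonTrivial⇒n>1 p {{prime⇒nonTrivial pr}}) (m≤m*n p q {{m^n≢0 p e}})))))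

  private
    suc[p-1] : suc (p ∸ 1) ≡ p
    suc[p-1] = suc-pred p

  oddZeroCond⇒∣ : ∀ {n} → OddZeroCond n p → ∀ j → 1 ≤ j → j * (p ∸ 1) ≤ n → p ∣ suc n C (j * (p ∸ 1))
  oddZeroCond⇒∣ {n} (p∤n+2 , p∣C) j 1≤j j[p-1]≤n = case-j j 1≤j j[p-1]≤n
    where
    p∣C₁ : p ∣ suc n C (p ∸ 1)
    p∣C₁ = p∤1+n⇒p∣nC[p-1] pr (p∤n+2 ∘ subst (p ∣_) (+-comm 2 n))
    case-j : ∀ j → 1 ≤ j → j * (p ∸ 1) ≤ n → p ∣ suc n C (j * (p ∸ 1))
    case-j (suc zero) _ _ = subst (λ t → p ∣ suc n C t) (sym (*-identityˡ (p ∸ 1))) p∣C₁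
    case-j j@(suc (suc _)) _ j[p-1]≤n with m≤n⇒m<n∨m≡n (≤-floorDiv (p ∸ 1) (0<p-1 pr) j[p-1]≤n)
    ... | inj₁ j< = p∣C j (s≤s (s≤s z≤n)) (∸-monoˡ-≤ 1 j<)
    ... | inj₂ j≡ with p ∣? suc n C (j * (p ∸ 1))
    ...   | yes p∣ = p∣
    ...   | no p∤ with smaller-index p≤k (s≤s j[p-1]≤n) 1+n<k+p p∤
      where
      -- This uses j ≥ 2; it ensures a nonzero higher digit to borrow from.
      p≤k : p ≤ j * (p ∸ 1)
      p≤k = begin
        p                        ≡⟨ suc[p-1] ⟨
        1 + (p ∸ 1)              ≤⟨ +-monoˡ-≤ (p ∸ 1) (0<p-1 pr) ⟩
        (p ∸ 1) + (p ∸ 1)        ≡⟨ cong (p ∸ 1 +_) (+-identityʳ (p ∸ 1)) ⟨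
        2 * (p ∸ 1)              ≤⟨ *-monoˡ-≤ (p ∸ 1) {2} {j} (s≤s (s≤s z≤n)) ⟩
        j * (p ∸ 1)              ∎
        where open ≤-Reasoning
      -- Otherwise (j+1)(p-1) ≤ n, although j is the floor of n/(p-1).
      1+n<k+p : suc n < j * (p ∸ 1) + p
      1+n<k+p with suc n <? j * (p ∸ 1) + p
      ... | yes lt = lt
      ... | no ≮ = contradiction (≤-floorDiv {n} {suc j} (p ∸ 1) (0<p-1 pr) (s≤s⁻¹ (begin
        suc ((p ∸ 1) + j * (p ∸ 1)) ≡⟨ cong (_+ j * (p ∸ 1)) suc[p-1] ⟩
        p + j * (p ∸ 1)             ≡⟨ +-comm p _ ⟩
        j * (p ∸ 1) + p             ≤⟨ ≮⇒≥ ≮ ⟩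
        suc n                       ∎))) (<⇒≱ (s≤s (≤-reflexive (sym j≡))))
        where open ≤-Reasoning
    ...     | k′ , 0<k′ , k′<k , p∤C′ , e , k≡ = contradiction p∣C′ p∤C′
      where
      p-1∣k′ : p ∸ 1 ∣ k′
      p-1∣k′ = ∣m+n∣m⇒∣n (subst (p ∸ 1 ∣_) (trans k≡ (+-comm k′ _)) (n∣m*n j))
        (subst (λ t → p ∸ 1 ∣ pred (t ^ suc e)) suc[p-1] (a∣a^n-1 (p ∸ 1) (suc e)))
      p∣C′ : p ∣ suc n C k′
      p∣C′ with p-1∣k′
      ... | divides zero refl = contradiction 0<k′ λ ()
      ... | divides (suc zero) refl = subst (λ t → p ∣ suc n C t) (sym (*-identityˡ (p ∸ 1))) p∣C₁
      ... | divides j′@(suc (suc _)) refl = p∣C j′ (s≤s (s≤s z≤n))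
              (∸-monoˡ-≤ 1 (subst (j′ <_) j≡ (*-cancelʳ-< (p ∸ 1) j′ j k′<k)))

  -- A failure comes with an index j that witnesses it: j = 1 if p divides n + 2, which p - 1 ≤ n
  -- makes admissible, and otherwise the result of a bounded search.
  oddZeroCond? : ∀ n → p ∸ 1 ≤ n →
    OddZeroCond n p ⊎ (¬ OddZeroCond n p × ∃[ j ] (1 ≤ j × j * (p ∸ 1) ≤ n × ¬ p ∣ suc n C (j * (p ∸ 1))))
  oddZeroCond? n p-1≤n with p ∣? n + 2
  ... | yes p∣n+2 = inj₂ ((λ z → proj₁ z p∣n+2) , 1 , ≤-refl , subst (_≤ n) (sym (*-identityˡ (p ∸ 1))) p-1≤n ,
          subst (λ t → ¬ p ∣ suc n C t) (sym (*-identityˡ (p ∸ 1)))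
            (p∣1+n⇒p∤nCk pr (p ∸ 1) (subst (p ∣_) (+-comm n 2) p∣n+2) (≤-reflexive suc[p-1])))
  ... | no p∤n+2 with anyUpTo? (λ j → (2 ≤? j) ×-dec ¬? (p ∣? suc n C (j * (p ∸ 1)))) (floorDiv n (p ∸ 1))
  ...   | yes (j , j< , 2≤j , p∤) = inj₂ ((λ z → p∤ (proj₂ z j 2≤j (∸-monoˡ-≤ 1 j<))) ,
            j , ≤-trans (s≤s z≤n) 2≤j , floorDiv-≤ (p ∸ 1) (0<p-1 pr) (<⇒≤ j<) , p∤)
  ...   | no ∄ = inj₁ (p∤n+2 , λ j 2≤j j≤J-1 → decidable-stable (p ∣? _)
            (λ p∤ → ∄ (j , j≤k∸1⇒j<k (≤-trans (s≤s z≤n) 2≤j) j≤J-1 , 2≤j , p∤)))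

-- The bound M_n and the exponent of 2

/-<⇒<* : ∀ {m n k} .{{_ : NonZero k}} → m / k < n → m < n * k
/-<⇒<* {m} {n} {k} m/k<n = ≰⇒> λ nk≤m → <⇒≱ m/k<n (subst (_≤ m / k) (m*n/n≡m n k) (/-monoˡ-≤ k nk≤m))

floorM-even : ∀ n → n % 2 ≡ 0 → floorM n ≡ (n + 2) / 2
floorM-even n eq rewrite eq = refl

floorM-odd : ∀ n {r} → n % 2 ≡ suc r → floorM n ≡ (n + 2) / 3
floorM-odd n eq rewrite eq = refl

floorM-parity : ∀ n → (2 ∣ n × floorM n ≡ (n + 2) / 2) ⊎ (¬ 2 ∣ n × floorM n ≡ (n + 2) / 3)
floorM-parity n = by-remainder (n % 2) refl
  where
  by-remainder : ∀ r → n % 2 ≡ r → (2 ∣ n × floorM n ≡ (n + 2) / 2) ⊎ (¬ 2 ∣ n × floorM n ≡ (n + 2) / 3)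
  by-remainder zero    eq = inj₁ (m%n≡0⇒n∣m n 2 eq , floorM-even n eq)
  by-remainder (suc r) eq = inj₂ ((λ 2∣n → 1+n≢0 (trans (sym eq) (n∣m⇒m%n≡0 n 2 2∣n))) , floorM-odd n eq)

floorM≤1+n : ∀ n → floorM n ≤ suc n
floorM≤1+n n = s≤s⁻¹ (subst (suc (floorM n) ≤_) (+-comm n 2) floorM<n+2)
  where
  floorM<n+2 : floorM n < n + 2
  floorM<n+2 with floorM-parity n
  ... | inj₁ (_ , eq) = subst (_< n + 2) (sym eq) (m/n<m (n + 2) 2 {{≢-nonZero (m+1+n≢0 n)}} (s≤s (s≤s z≤n)))
  ... | inj₂ (_ , eq) = subst (_< n + 2) (sym eq) (m/n<m (n + 2) 3 {{≢-nonZero (m+1+n≢0 n)}} (s≤s (s≤s z≤n)))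

≤floorM⇒∸1≤ : ∀ {m} n → m ≤ floorM n → m ∸ 1 ≤ n
≤floorM⇒∸1≤ n m≤ = ∸-monoˡ-≤ 1 (≤-trans m≤ (floorM≤1+n n))

¬2∣[1+n]⇒2∣n : ∀ n → ¬ 2 ∣ suc n → 2 ∣ n
¬2∣[1+n]⇒2∣n zero          _   = 2 ∣0
¬2∣[1+n]⇒2∣n (suc zero)    odd = contradiction ∣-refl odd
¬2∣[1+n]⇒2∣n (suc (suc n)) odd = ∣m∣n⇒∣m+n (∣-refl {2}) (¬2∣[1+n]⇒2∣n n (odd ∘ ∣m∣n⇒∣m+n (∣-refl {2})))

-- For even n the bound gives n + 2 < 2p, which leaves only n + 2 = p, against p ≤ n + 1, and
-- contradicts 3(p-1) ≤ n. For odd n it gives n + 2 < 3p: now n + 2 = 2p fails by parity, and 3(p-1)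
-- ≤ n would force n = 3(p-1), an even number. This explains the divisors 2 and 3 in M_n.
floorM<p⇒oddZeroCond : ∀ {p n} → Prime p → 3 ≤ p → floorM n < p → p ∸ 1 ≤ n → OddZeroCond n p
floorM<p⇒oddZeroCond {zero} _ ()
floorM<p⇒oddZeroCond {p@(suc q)} {n} pr 3≤p M<p q≤n = [ even , odd ]′ (floorM-parity n)
  where
  -- An intermediate j is at least 2 and has j + 1 below or at the floor of n/(p-1), so 3(p-1) ≤ n.
  3q≤n : ∀ j → 2 ≤ j → j ≤ floorDiv n q ∸ 1 → 3 * q ≤ n
  3q≤n j 2≤j j≤ = ≤-trans (*-monoˡ-≤ q (s≤s 2≤j)) (floorDiv-≤ {n} {suc j} q (≤-trans (s≤s z≤n) (s≤s⁻¹ 3≤p)) (j≤k∸1⇒j<k (≤-trans (s≤s z≤n) 2≤j) j≤))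
  n+2≢p : n + 2 ≢ p
  n+2≢p eq = <⇒≱ (subst (_< n + 2) (+-comm n 1) (+-monoʳ-< n {1} {2} (n<1+n 1))) (subst (_≤ suc n) (sym eq) (s≤s q≤n))

  even : 2 ∣ n × floorM n ≡ (n + 2) / 2 → OddZeroCond n p
  even (2∣n , eq) = p∤n+2 , λ j 2≤j j≤ → contradiction (begin-strict
      n + 2                 <⟨ n+2<2p ⟩
      p * 2                 ≡⟨ *-comm p 2 ⟩
      2 * p                 ≡⟨ 2[1+q] q ⟩
      2 * q + 2             ≤⟨ +-monoˡ-≤ 2 (*-monoˡ-≤ q (n≤1+n 2)) ⟩
      3 * q + 2             ≤⟨ +-monoˡ-≤ 2 (3q≤n j 2≤j j≤) ⟩
      n + 2                 ∎) (<-irrefl refl)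
    where
    open ≤-Reasoning
    2[1+q] : ∀ q → 2 * suc q ≡ 2 * q + 2
    2[1+q] = solve-∀
    n+2<2p : n + 2 < p * 2
    n+2<2p = /-<⇒<* (subst (_< p) eq M<p)
    p∤n+2 : ¬ p ∣ n + 2
    p∤n+2 (divides zero          eq) = m+1+n≢0 n eq
    p∤n+2 (divides (suc zero)    eq) = n+2≢p (trans eq (*-identityˡ p))
    p∤n+2 (divides (suc (suc t)) eq) = <⇒≱ n+2<2p (subst (p * 2 ≤_) (sym (trans eq (*-comm (2 + t) p))) (*-monoʳ-≤ p {2} (s≤s (s≤s z≤n))))

  odd : ¬ 2 ∣ n × floorM n ≡ (n + 2) / 3 → OddZeroCond n p
  odd (2∤n , eq) = p∤n+2 , λ j 2≤j j≤ → contradiction (subst (2 ∣_) (≤-antisym (3q≤n j 2≤j j≤) n≤3q) (∣n⇒∣m*n 3 2∣q)) 2∤n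
    where
    open ≤-Reasoning
    n+2<3p : n + 2 < p * 3
    n+2<3p = /-<⇒<* (subst (_< p) eq M<p)
    n≤3q : n ≤ 3 * q
    n≤3q = +-cancelʳ-≤ 3 n (3 * q) (subst₂ _≤_ (sym (+-suc n 2)) (3[1+q] q) n+2<3p)
      where
      3[1+q] : ∀ q → suc q * 3 ≡ 3 * q + 3
      3[1+q] = solve-∀
    2∣q : 2 ∣ q
    2∣q = ¬2∣[1+n]⇒2∣n q λ 2∣p → case prime⇒irreducible pr 2∣p of λ where
      (inj₁ ())
      (inj₂ 2≡p) → <⇒≱ 3≤p (≤-reflexive (sym 2≡p))
    p∤n+2 : ¬ p ∣ n + 2
    p∤n+2 (divides zero                eq) = m+1+n≢0 n eq
    p∤n+2 (divides (suc zero)          eq) = n+2≢p (trans eq (*-identityˡ p))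
    p∤n+2 (divides (suc (suc zero))    eq) = 2∤n (∣m+n∣m⇒∣n (subst (2 ∣_) (trans (sym eq) (+-comm n 2)) (m∣m*n p)) ∣-refl)
    p∤n+2 (divides (suc (suc (suc t))) eq) = <⇒≱ n+2<3p (subst (p * 3 ≤_) (sym (trans eq (*-comm (3 + t) p))) (*-monoʳ-≤ p {3} (s≤s (s≤s (s≤s z≤n)))))

-- The bound is below 2 only for n = 0, 1, 3, all of the form 2^r - 1. So the factor 2 lies in the
-- range of the product whenever it is needed.
¬mersenne⇒2≤floorM : ∀ n → ¬ IsMersenneIndex n → 2 ≤ floorM n
¬mersenne⇒2≤floorM 0 ¬m = contradiction (0 , refl) ¬m
¬mersenne⇒2≤floorM 1 ¬m = contradiction (1 , refl) ¬m
¬mersenne⇒2≤floorM 2 ¬m = s≤s (s≤s z≤n)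
¬mersenne⇒2≤floorM 3 ¬m = contradiction (2 , refl) ¬m
¬mersenne⇒2≤floorM n@(suc (suc (suc (suc m)))) ¬m = case floorM-parity n of λ where
    (inj₁ (_ , eq)) → subst (2 ≤_) (sym eq) (/-monoˡ-≤ {4} 2 (≤-trans (m≤m+n 4 2) 6≤n+2))
    (inj₂ (_ , eq)) → subst (2 ≤_) (sym eq) (/-monoˡ-≤ {6} 3 6≤n+2)
  where
  6≤n+2 : 6 ≤ n + 2
  6≤n+2 = subst (6 ≤_) (+-comm 2 n) (m≤m+n 6 m)

-- The index k is the 2^e with C(n+1, 2^e) odd. It is n+1 itself exactly in the Mersenne case;
-- otherwise k ≤ n, and k is 1 or even, so that B_k has a pole at 2.
mersenne? : ∀ n →
  (IsMersenneIndex n × (∀ k → 0 < k → k ≤ n → 2 ∣ suc n C k)) ⊎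
  (¬ IsMersenneIndex n × ∃[ k ] (0 < k × k ≤ n × (k ≡ 1 ⊎ 2 ∣ k) × ¬ 2 ∣ suc n C k))
mersenne? n with ∃[p^e]p∤aC[p^e] prime[2] (suc n) z<s
... | e , 2^e≤1+n , 2∤C with m≤n⇒m<n∨m≡n 2^e≤1+n
...   | inj₂ 2^e≡1+n = inj₁ ((e , sym 2^e≡1+n) , λ k 0<k k≤n →
          subst (λ t → 2 ∣ t C k) 2^e≡1+n (p∣[p^r]Ck prime[2] e 0<k (subst (k <_) (sym 2^e≡1+n) (s≤s k≤n))))
...   | inj₁ 2^e<1+n = inj₂ (¬mersenne , 2 ^ e , m^n>0 2 e , s≤s⁻¹ 2^e<1+n , 1-or-even e , 2∤C)
  where
  ¬mersenne : ¬ IsMersenneIndex n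
  ¬mersenne (r , 1+n≡2^r) = 2∤C (subst (λ t → 2 ∣ t C (2 ^ e)) (sym 1+n≡2^r)
    (p∣[p^r]Ck prime[2] r (m^n>0 2 e) (subst (2 ^ e <_) 1+n≡2^r 2^e<1+n)))
  1-or-even : ∀ e → 2 ^ e ≡ 1 ⊎ 2 ∣ 2 ^ e
  1-or-even zero    = inj₁ refl
  1-or-even (suc e) = inj₂ (m∣m*n (2 ^ e))

-- Denominators of the power sum polynomials

∃-primeDivisor : ∀ n .{{_ : NonZero n}} → n ≢ 1 → ∃[ p ] (Prime p × p ∣ n)
∃-primeDivisor n n≢1 with factorise n
... | record { factors = []     ; isFactorisation = n≡1 } = contradiction n≡1 n≢1
... | record { factors = p ∷ ps ; isFactorisation = n≡ ; factorsPrime = pr ∷ _ } =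
  p , pr , subst (p ∣_) (sym n≡) (m∣m*n _)

numerator : ∀ n d-1 .(cop : Coprime ℤ.∣ n ∣ (suc d-1)) → mkℚ n d-1 cop *ℚ ℕtoℚ (suc d-1) ≡ ℤtoℚ n
numerator n d-1 cop = ℚ.toℚᵘ-injective (begin
  toℚᵘ (mkℚ n d-1 cop *ℚ ℕtoℚ (suc d-1))       ≈⟨ ℚ.toℚᵘ-homo-* (mkℚ n d-1 cop) (ℕtoℚ (suc d-1)) ⟩
  mkℚᵘ n d-1 ℚᵘ.* toℚᵘ (ℕtoℚ (suc d-1))        ≈⟨ ℚᵘ.*-congˡ {mkℚᵘ n d-1} (toℚᵘ-ℤtoℚ (pos (suc d-1))) ⟩
  mkℚᵘ n d-1 ℚᵘ.* mkℚᵘ (pos (suc d-1)) 0           ≈⟨ *≡* (trans (ℤ.*-identityʳ _) (cong (λ t → n ℤ.* pos t) (sym (*-identityʳ (suc d-1))))) ⟩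
  mkℚᵘ n 0                                     ≈⟨ toℚᵘ-ℤtoℚ n ⟨
  toℚᵘ (ℤtoℚ n)                                ∎)
  where open ℚᵘ.≃-Reasoning

-- Integrality as a local property

IsInt⇒Loc : ∀ {p a} → Prime p → IsInt a → Loc p a
IsInt⇒Loc {p} pr (pos n      , refl) = subst (Loc p) (ι≡ℕtoℚ n) (Loc-ι pr n)
IsInt⇒Loc {p} pr (-[1+ n ] , refl) = subst (Loc p) (trans (cong -ℚ_ (ι≡ℕtoℚ (suc n))) (sym (ℤtoℚ-neg (pos (suc n))))) (Loc-neg pr (Loc-ι pr (suc n)))

Loc⇒∣ : ∀ {p n d-1} .{cop : Coprime ℤ.∣ n ∣ (suc d-1)} → Loc p (mkℚ n d-1 cop) → ∃[ m ] (¬ p ∣ m × suc d-1 ∣ m * ℤ.∣ n ∣)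
Loc⇒∣ {p} {n} {d-1} {cop} (m , x , y , p∤m , eq) = m , p∤m , divides ℤ.∣ z ∣ (begin
    m * ℤ.∣ n ∣                 ≡⟨ ℤ.abs-* (pos m) n ⟨
    ℤ.∣ pos m ℤ.* n ∣             ≡⟨ cong ℤ.∣_∣ (ℤtoℚ-injective {pos m ℤ.* n} {z ℤ.* pos (suc d-1)} mn≡zd) ⟩
    ℤ.∣ z ℤ.* pos (suc d-1) ∣       ≡⟨ ℤ.abs-* z (pos (suc d-1)) ⟩
    ℤ.∣ z ∣ * suc d-1           ∎)
  where
  open ≡-Reasoning
  a : ℚ
  a = mkℚ n d-1 cop
  z : ℤ
  z = pos x ℤ.+ ℤ.- pos y
  ma≡z : ι m *ℚ a ≡ ℤtoℚ z
  ma≡z = begin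
    ι m *ℚ a                              ≡⟨ solve 2 (λ s t → s := s :+ t :+ (:- t)) refl (ι m *ℚ a) (ι y) ⟩
    ι m *ℚ a +ℚ ι y +ℚ (-ℚ ι y)           ≡⟨ cong (_+ℚ (-ℚ ι y)) eq ⟩
    ι x +ℚ (-ℚ ι y)                       ≡⟨ cong₂ (λ s t → s +ℚ (-ℚ t)) (ι≡ℕtoℚ x) (ι≡ℕtoℚ y) ⟩
    ℤtoℚ (pos x) +ℚ (-ℚ ℤtoℚ (pos y))         ≡⟨ cong (ℤtoℚ (pos x) +ℚ_) (ℤtoℚ-neg (pos y)) ⟨
    ℤtoℚ (pos x) +ℚ ℤtoℚ (ℤ.- pos y)          ≡⟨ ℤtoℚ-+ (pos x) (ℤ.- pos y) ⟨
    ℤtoℚ z                                ∎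
  mn≡zd : ℤtoℚ (pos m ℤ.* n) ≡ ℤtoℚ (z ℤ.* pos (suc d-1))
  mn≡zd = begin
    ℤtoℚ (pos m ℤ.* n)                      ≡⟨ ℤtoℚ-* (pos m) n ⟩
    ℕtoℚ m *ℚ ℤtoℚ n                      ≡⟨ cong (ℕtoℚ m *ℚ_) (numerator n d-1 cop) ⟨
    ℕtoℚ m *ℚ (a *ℚ ℕtoℚ (suc d-1))       ≡⟨ ℚ.*-assoc (ℕtoℚ m) a (ℕtoℚ (suc d-1)) ⟨
    ℕtoℚ m *ℚ a *ℚ ℕtoℚ (suc d-1)         ≡⟨ cong (λ t → t *ℚ a *ℚ ℕtoℚ (suc d-1)) (ι≡ℕtoℚ m) ⟨
    ι m *ℚ a *ℚ ℕtoℚ (suc d-1)            ≡⟨ cong (_*ℚ ℕtoℚ (suc d-1)) ma≡z ⟩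
    ℤtoℚ z *ℚ ℕtoℚ (suc d-1)              ≡⟨ ℤtoℚ-* z (pos (suc d-1)) ⟨
    ℤtoℚ (z ℤ.* pos (suc d-1))                ∎

-- A prime p dividing the reduced denominator would divide m times the numerator for some m prime to
-- p, hence the numerator, against coprimality.
Loc⇒IsInt : ∀ a → (∀ p → Prime p → Loc p a) → IsInt a
Loc⇒IsInt (mkℚ n zero      cop) _   = n , trans (sym (ℚ.*-identityʳ (mkℚ n 0 cop))) (numerator n 0 cop)
Loc⇒IsInt (mkℚ n d-1@(suc _) cop) loc =
  let p , pr , p∣d = ∃-primeDivisor (suc d-1) λ ()
      m , p∤m , d∣m∣n∣ = Loc⇒∣ (loc p pr)
      p∣∣n∣ = prime∣*∤⇒∣ pr m ℤ.∣ n ∣ (∣-trans p∣d d∣m∣n∣) p∤m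
  in contradiction (subst Prime (Coprimality.recompute cop (p∣∣n∣ , p∣d)) pr) ¬prime[1]

-- Read off from `faulhaber`. Where `n ∸ i` is truncated, that is for i > n, the binomial
-- coefficient is already 0.
powerSumCoef : ℕ → ℕ → ℚ
powerSumCoef n zero    = 0ℚ
powerSumCoef n (suc i) = recip n *ℚ (ι (suc n C suc i) *ℚ B (n ∸ i))

powerSumCoef-high : ∀ n i → 2 + n ≤ i → powerSumCoef n i ≡ 0ℚ
powerSumCoef-high n (suc i) (s≤s n<i) = begin
  recip n *ℚ (ι (suc n C suc i) *ℚ B (n ∸ i)) ≡⟨ cong (λ t → recip n *ℚ (t *ℚ B (n ∸ i))) (trans (cong ι (k>n⇒nCk≡0 (s≤s n<i))) ι-0) ⟩
  recip n *ℚ (0ℚ *ℚ B (n ∸ i))                ≡⟨ cong (recip n *ℚ_) (ℚ.*-zeroˡ (B (n ∸ i))) ⟩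
  recip n *ℚ 0ℚ                               ≡⟨ ℚ.*-zeroʳ (recip n) ⟩
  0ℚ                                          ∎
  where open ≡-Reasoning

coef≡powerSumCoef : ∀ n c → IsPowerSumPoly n c → ∀ i → coef c i ≡ powerSumCoef n i
coef≡powerSumCoef n c isPSP i = trans (coef-unique c e c≡e i) (coef-applyUpTo (powerSumCoef n) {2 + n} (powerSumCoef-high n) i)
  where
  open ≡-Reasoning
  e : Poly
  e = applyUpTo (powerSumCoef n) (2 + n)
  shuffle : ∀ x j → ι (x ^ suc j) *ℚ powerSumCoef n (suc j) ≡ recip n *ℚ (ι (suc n C suc j) *ℚ (ι (x ^ suc j) *ℚ B (n ∸ j)))
  shuffle x j = solve 4 (λ y r c b → y :* (r :* (c :* b)) := r :* (c :* (y :* b))) refl (ι (x ^ suc j)) (recip n) (ι (suc n C suc j)) (B (n ∸ j))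
  c≡e : ∀ x → 1 ≤ x → eval c (ι x) ≡ eval e (ι x)
  c≡e x 1≤x = begin
    eval c (ι x)                                  ≡⟨ cong (eval c) (ι≡ℕtoℚ x) ⟩
    eval c (ℕtoℚ x)                               ≡⟨ isPSP x 1≤x ⟩
    ℕtoℚ (powerSum n x)                           ≡⟨ ι≡ℕtoℚ (powerSum n x) ⟨
    ι (powerSum n x)                              ≡⟨ ℚ.*-identityˡ (ι (powerSum n x)) ⟨
    1ℚ *ℚ ι (powerSum n x)                        ≡⟨ cong (_*ℚ ι (powerSum n x)) (*-recip n) ⟨
    ι (suc n) *ℚ recip n *ℚ ι (powerSum n x)      ≡⟨ solve 3 (λ a r s → a :* r :* s := r :* (a :* s)) refl (ι (suc n)) (recip n) (ι (powerSum n x)) ⟩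
    recip n *ℚ (ι (suc n) *ℚ ι (powerSum n x))    ≡⟨ cong (recip n *ℚ_) (faulhaber n x) ⟨
    recip n *ℚ ∑ (suc n) (λ j → ι (suc n C suc j) *ℚ (ι (x ^ suc j) *ℚ B (n ∸ j)))
      ≡⟨ ∑-* (suc n) (recip n) (λ j → ι (suc n C suc j) *ℚ (ι (x ^ suc j) *ℚ B (n ∸ j))) ⟨
    ∑ (suc n) (λ j → recip n *ℚ (ι (suc n C suc j) *ℚ (ι (x ^ suc j) *ℚ B (n ∸ j))))
      ≡⟨ ∑-cong (suc n) (λ j _ → shuffle x j) ⟨
    ∑ (suc n) (λ j → ι (x ^ suc j) *ℚ powerSumCoef n (suc j))
      ≡⟨ ℚ.+-identityˡ _ ⟨
    0ℚ +ℚ ∑ (suc n) (λ j → ι (x ^ suc j) *ℚ powerSumCoef n (suc j))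
      ≡⟨ cong (_+ℚ ∑ (suc n) (λ j → ι (x ^ suc j) *ℚ powerSumCoef n (suc j))) (ℚ.*-zeroʳ (ι (x ^ 0))) ⟨
    ∑ (2 + n) (λ j → ι (x ^ j) *ℚ powerSumCoef n j)
      ≡⟨ eval-applyUpTo (powerSumCoef n) (2 + n) x ⟨
    eval e (ι x) ∎

IsInt-*0 : ∀ a → IsInt (a *ℚ 0ℚ)
IsInt-*0 a = pos 0 , ℚ.*-zeroʳ a

integerCoeffs⇒ : ∀ a c → IntegerCoeffs (scale a c) → ∀ i → IsInt (a *ℚ coef c i)
integerCoeffs⇒ a []      _          i       = IsInt-*0 a
integerCoeffs⇒ a (b ∷ c) (int ∷ _)  zero    = int
integerCoeffs⇒ a (b ∷ c) (_ ∷ ints) (suc i) = integerCoeffs⇒ a c ints i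

⇒integerCoeffs : ∀ a c → (∀ i → IsInt (a *ℚ coef c i)) → IntegerCoeffs (scale a c)
⇒integerCoeffs a []      _   = []
⇒integerCoeffs a (b ∷ c) int = int 0 ∷ ⇒integerCoeffs a c (int ∘ suc)

-- The reflection C(n+1, i+1) = C(n+1, n-i) gives the binomial coefficient and the Bernoulli number
-- the same index k = n - i.
[1+n]q*coef : ∀ n q i → i ≤ n → ι (q * suc n) *ℚ powerSumCoef n (suc i) ≡ ι q *ℚ (ι (suc n C (n ∸ i)) *ℚ B (n ∸ i))
[1+n]q*coef n q i i≤n = begin
  ι (q * suc n) *ℚ (recip n *ℚ (ι (suc n C suc i) *ℚ B (n ∸ i)))
    ≡⟨ cong₂ (λ s t → s *ℚ (recip n *ℚ (ι t *ℚ B (n ∸ i)))) (ι-* q (suc n)) (nCk≡nC[n∸k] (s≤s i≤n)) ⟩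
  ι q *ℚ ι (suc n) *ℚ (recip n *ℚ x)
    ≡⟨ solve 4 (λ q a r x → q :* a :* (r :* x) := q :* (a :* r :* x)) refl (ι q) (ι (suc n)) (recip n) x ⟩
  ι q *ℚ (ι (suc n) *ℚ recip n *ℚ x)
    ≡⟨ cong (λ t → ι q *ℚ (t *ℚ x)) (*-recip n) ⟩
  ι q *ℚ (1ℚ *ℚ x)
    ≡⟨ cong (ι q *ℚ_) (ℚ.*-identityˡ x) ⟩
  ι q *ℚ x ∎
  where
  open ≡-Reasoning
  x : ℚ
  x = ι (suc n C (n ∸ i)) *ℚ B (n ∸ i)

-- Products over primes

primeProd-suc : ∀ m f → (Prime (suc m) × primeProd (suc m) f ≡ f (suc m) * primeProd m f) ⊎ primeProd (suc m) f ≡ primeProd m f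
primeProd-suc m f with prime? (suc m)
... | yes pr = inj₁ (pr , refl)
... | no  _  = inj₂ (*-identityˡ (primeProd m f))

∣primeProd : ∀ {p} m f → Prime p → p ≤ m → f p ∣ primeProd m f
∣primeProd zero    f pr z≤n = contradiction pr ¬prime[0]
∣primeProd (suc m) f pr p≤1+m with prime? (suc m) | m≤n⇒m<n∨m≡n p≤1+m
... | yes _ | inj₂ refl  = m∣m*n (primeProd m f)
... | no ¬p | inj₂ refl  = contradiction pr ¬p
... | yes _ | inj₁ p<1+m = ∣n⇒∣m*n (f (suc m)) (∣primeProd m f pr (s≤s⁻¹ p<1+m))
... | no _  | inj₁ p<1+m = ∣n⇒∣m*n 1 (∣primeProd m f pr (s≤s⁻¹ p<1+m))

module _ {p : ℕ} (pr : Prime p) where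

  ∣^⇒∣ : ∀ r k → p ∣ r ^ k → p ∣ r
  ∣^⇒∣ r zero    p∣1 = contradiction p∣1 (prime∤1 pr)
  ∣^⇒∣ r (suc k) p∣  = [ id , ∣^⇒∣ r k ]′ (euclidsLemma r (r ^ k) pr p∣)

  ∤primeProd : ∀ m (ε : ℕ → ℕ) → m < p → ¬ p ∣ primeProd m (λ r → r ^ ε r)
  ∤primeProd zero    ε m<p = prime∤1 pr
  ∤primeProd (suc m) ε m<p with primeProd-suc m (λ r → r ^ ε r)
  ... | inj₁ (_ , eq) = λ p∣ → prime∤* pr (λ p∣r^ε → p∤1+k pr m<p (∣^⇒∣ (suc m) (ε (suc m)) p∣r^ε)) (∤primeProd m ε (<-trans (n<1+n m) m<p)) (subst (p ∣_) eq p∣)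
  ... | inj₂ eq       = λ p∣ → ∤primeProd m ε (<-trans (n<1+n m) m<p) (subst (p ∣_) eq p∣)

-- If q = s t with t the product over smaller primes, a new prime factor of q does not divide t, so
-- it divides s.
primeProd∣ : ∀ m (ε : ℕ → ℕ) q → (∀ p → Prime p → p ≤ m → ε p ≡ 0 ⊎ (ε p ≡ 1 × p ∣ q)) → primeProd m (λ r → r ^ ε r) ∣ q
primeProd∣ zero    ε q h = 1∣ q
primeProd∣ (suc m) ε q h with primeProd-suc m (λ r → r ^ ε r) | primeProd∣ m ε q (λ p pr p≤m → h p pr (m≤n⇒m≤1+n p≤m))
... | inj₂ eq        | ih = subst (_∣ q) (sym eq) ih
... | inj₁ (pr , eq) | divides s q≡s*t with h (suc m) pr ≤-refl
...   | inj₁ ε≡0         = subst (_∣ q) (sym (trans eq (trans (cong (λ k → suc m ^ k * t) ε≡0) (*-identityˡ t)))) (divides s q≡s*t)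
  where
  t : ℕ
  t = primeProd m (λ r → r ^ ε r)
...   | inj₂ (ε≡1 , p∣q) = subst₂ _∣_ (sym (trans eq (cong (_* t) (trans (cong (suc m ^_) ε≡1) (*-identityʳ (suc m)))))) (sym q≡s*t)
        (*-monoˡ-∣ t (prime∣*∤⇒∣ pr t s (subst (suc m ∣_) (trans q≡s*t (*-comm s t)) p∣q) (∤primeProd pr m ε (n<1+n m))))
  where
  t : ℕ
  t = primeProd m (λ r → r ^ ε r)

primeProd>0 : ∀ m (ε : ℕ → ℕ) → 0 < primeProd m (λ r → r ^ ε r)
primeProd>0 zero    ε = z<s
primeProd>0 (suc m) ε with primeProd-suc m (λ r → r ^ ε r)
... | inj₁ (_ , eq) = subst (0 <_) (sym eq) (*-mono-≤ (m^n>0 (suc m) (ε (suc m))) (primeProd>0 m ε))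
... | inj₂ eq       = subst (0 <_) (sym eq) (primeProd>0 m ε)

prime≢2⇒3≤ : ∀ {p} → Prime p → p ≢ 2 → 3 ≤ p
prime≢2⇒3≤ {p} pr p≢2 = ≤∧≢⇒< (nonTrivial⇒n>1 p {{prime⇒nonTrivial pr}}) (p≢2 ∘ sym)

Loc-p*B : ∀ {p} → Prime p → ∀ k → Loc p (ι p *ℚ B k)
Loc-p*B {p} pr k with p ≟ 2
... | yes refl = PrimeTwo.Loc-2*B k
... | no p≢2   = OddPrime.Loc-p*B pr (prime≢2⇒3≤ pr p≢2) k

∣⇒Loc-*B : ∀ {p c} → Prime p → p ∣ c → ∀ k → Loc p (ι c *ℚ B k)
∣⇒Loc-*B {p} pr (divides q refl) k = subst (Loc p)
  (trans (sym (ℚ.*-assoc (ι q) (ι p) (B k))) (cong (_*ℚ B k) (sym (ι-* q p))))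
  (Loc-* pr (Loc-ι pr q) (Loc-p*B pr k))

-- The prime factors of q_n

module _ (n : ℕ) (ε : ℕ → ℕ) (spec : EpsSpec n ε) where

  Integral : ℕ → Set
  Integral p = ∀ k → k ≤ n → Loc p (ι (suc n C k) *ℚ B k)

  -- Expresses that p divides the common denominator without naming it: every multiplier that
  -- removes p from all denominators is divisible by p.
  Polar : ℕ → Set
  Polar p = ∀ q → (∀ k → k ≤ n → Loc p (ι q *ℚ (ι (suc n C k) *ℚ B k))) → p ∣ q

  private
    Loc-C*B-0 : ∀ {p} → Prime p → Loc p (ι (suc n C 0) *ℚ B 0)
    Loc-C*B-0 {p} pr = Loc-* pr (Loc-ι pr 1) (subst (Loc p) (sym B-0) (Loc-ι pr 1))

    polar : ∀ {p} k → Prime p → k ≤ n → ¬ p ∣ suc n C k → (∀ c → Loc p (ι c *ℚ B k) → p ∣ c) → Polar p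
    polar {p} k pr k≤n p∤C p∣-of-Loc q loc = prime∣*∤⇒∣ pr (suc n C k) q
      (p∣-of-Loc ((suc n C k) * q) (subst (Loc p) assoc (loc k k≤n))) p∤C
      where
      assoc : ι q *ℚ (ι (suc n C k) *ℚ B k) ≡ ι ((suc n C k) * q) *ℚ B k
      assoc = trans (solve 3 (λ q c b → q :* (c :* b) := c :* q :* b) refl (ι q) (ι (suc n C k)) (B k)) (cong (_*ℚ B k) (sym (ι-* (suc n C k) q)))

    -- The zero condition is requested only under p - 1 ≤ n, which any positive multiple k ≤ n of p
    -- - 1 provides; k = 0 is harmless as B_0 = 1.
    odd-integral : ∀ {p} → Prime p → 3 ≤ p → (p ∸ 1 ≤ n → OddZeroCond n p) → Integral p
    odd-integral {p} pr 3≤p zeroCond k k≤n with p ∸ 1 ∣? k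
    ... | no p-1∤k = Loc-* pr (Loc-ι pr (suc n C k)) (OddPrime.Loc-B pr 3≤p k p-1∤k)
    ... | yes (divides zero refl) = Loc-C*B-0 pr
    ... | yes (divides (suc j) refl) = ∣⇒Loc-*B pr
            (oddZeroCond⇒∣ pr (zeroCond (≤-trans (m≤m+n (p ∸ 1) (j * (p ∸ 1))) k≤n)) (suc j) (s≤s z≤n) k≤n) (suc j * (p ∸ 1))

    even-integral : (∀ k → 0 < k → k ≤ n → 2 ∣ suc n C k) → Integral 2
    even-integral 2∣C zero    k≤n = Loc-C*B-0 prime[2]
    even-integral 2∣C (suc k) k≤n = ∣⇒Loc-*B prime[2] (2∣C (suc k) z<s k≤n) (suc k)

    classify-odd : ∀ {p} → Prime p → p ≢ 2 → (Integral p × (p ≤ floorM n → ε p ≡ 0)) ⊎ (p ≤ floorM n × ε p ≡ 1 × Polar p)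
    classify-odd {p} pr p≢2 with p ≤? floorM n
    ... | no p≰M = inj₁ (odd-integral pr 3≤p (floorM<p⇒oddZeroCond pr 3≤p (≰⇒> p≰M)) , λ p≤M → contradiction p≤M p≰M)
      where
      3≤p : 3 ≤ p
      3≤p = prime≢2⇒3≤ pr p≢2
    ... | yes p≤M with oddZeroCond? pr n (≤floorM⇒∸1≤ n p≤M)
    ...   | inj₁ zeroCond = inj₁ (odd-integral pr (prime≢2⇒3≤ pr p≢2) (λ _ → zeroCond) , λ _ → proj₁ (proj₂ (proj₂ spec) p pr p≢2 p≤M) zeroCond)
    ...   | inj₂ (¬zeroCond , j , 1≤j , j[p-1]≤n , p∤C) = inj₂ (p≤M , proj₂ (proj₂ (proj₂ spec) p pr p≢2 p≤M) ¬zeroCond ,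
              polar (j * (p ∸ 1)) pr j[p-1]≤n p∤C (OddPrime.p∣-of-Loc-B pr 3≤p (j * (p ∸ 1)) 0<k (n∣m*n j)))
      where
      3≤p : 3 ≤ p
      3≤p = prime≢2⇒3≤ pr p≢2
      0<k : 0 < j * (p ∸ 1)
      0<k = *-mono-≤ 1≤j (0<p-1 pr)

    classify-2 : (Integral 2 × ε 2 ≡ 0) ⊎ (2 ≤ floorM n × ε 2 ≡ 1 × Polar 2)
    classify-2 with mersenne? n
    ... | inj₁ (mersenne , 2∣C) = inj₁ (even-integral 2∣C , proj₁ spec mersenne)
    ... | inj₂ (¬mersenne , zero , () , _)
    ... | inj₂ (¬mersenne , suc k , _ , k≤n , 1-or-even , 2∤C) =
      inj₂ (¬mersenne⇒2≤floorM n ¬mersenne , proj₁ (proj₂ spec) ¬mersenne ,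
            polar (suc k) prime[2] k≤n 2∤C (PrimeTwo.2∣-of-Loc-B k 1-or-even))

  -- `q∣` rests on primes with exponent 1 being polar, and `primeProd-clears` on all other primes
  -- being integral.
  classify : ∀ p → Prime p → (Integral p × (p ≤ floorM n → ε p ≡ 0)) ⊎ (p ≤ floorM n × ε p ≡ 1 × Polar p)
  classify p pr with p ≟ 2
  ... | no p≢2   = classify-odd pr p≢2
  ... | yes refl = [ (λ (int , ε≡0) → inj₁ (int , λ _ → ε≡0)) , inj₂ ]′ classify-2

  q∣ : ∀ q → (∀ k → k ≤ n → IsInt (ι q *ℚ (ι (suc n C k) *ℚ B k))) → primeProd (floorM n) (λ p → p ^ ε p) ∣ q
  q∣ q ints = primeProd∣ (floorM n) ε q λ p pr p≤M → case classify p pr of λ where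
    (inj₁ (_ , ε≡0))         → inj₁ (ε≡0 p≤M)
    (inj₂ (_ , ε≡1 , pol)) → inj₂ (ε≡1 , pol q (λ k k≤n → IsInt⇒Loc pr (ints k k≤n)))

  primeProd-clears : ∀ k → k ≤ n → IsInt (ι (primeProd (floorM n) (λ p → p ^ ε p)) *ℚ (ι (suc n C k) *ℚ B k))
  primeProd-clears k k≤n = Loc⇒IsInt _ λ p pr → case classify p pr of λ where
      (inj₁ (int , _))         → Loc-* pr (Loc-ι pr Q) (int k k≤n)
      (inj₂ (p≤M , ε≡1 , _)) → subst (Loc p) (swap (ι (suc n C k)) (ι Q) (B k))
        (Loc-* pr (Loc-ι pr (suc n C k)) (∣⇒Loc-*B pr
          (subst (_∣ Q) (trans (cong (p ^_) ε≡1) (*-identityʳ p)) (∣primeProd (floorM n) (λ p → p ^ ε p) pr p≤M)) k))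
    where
    Q : ℕ
    Q = primeProd (floorM n) (λ p → p ^ ε p)
    swap : ∀ a b c → a *ℚ (b *ℚ c) ≡ b *ℚ (a *ℚ c)
    swap = solve 3 (λ a b c → a :* (b :* c) := b :* (a :* c)) refl

-- As B_0 = 1, the leading coefficient is 1/(n+1). This is the integrality of q_n.
leading⇒∣ : ∀ n d → IsInt (ι d *ℚ powerSumCoef n (suc n)) → suc n ∣ d
leading⇒∣ n d (z , eq) = divides ℤ.∣ z ∣ (trans (cong ℤ.∣_∣ (ℤtoℚ-injective {pos d} {z ℤ.* pos (suc n)} (begin
  ℕtoℚ d                         ≡⟨ ι≡ℕtoℚ d ⟨
  ι d                            ≡⟨ trans (cong (ι d *ℚ_) (*-recip n)) (ℚ.*-identityʳ (ι d)) ⟨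
  ι d *ℚ (ι (suc n) *ℚ recip n)  ≡⟨ solve 3 (λ d a r → d :* (a :* r) := d :* r :* a) refl (ι d) (ι (suc n)) (recip n) ⟩
  ι d *ℚ recip n *ℚ ι (suc n)    ≡⟨ cong (λ t → ι d *ℚ t *ℚ ι (suc n)) leading ⟨
  ι d *ℚ powerSumCoef n (suc n) *ℚ ι (suc n) ≡⟨ cong₂ _*ℚ_ eq (ι≡ℕtoℚ (suc n)) ⟩
  ℤtoℚ z *ℚ ℕtoℚ (suc n)         ≡⟨ ℤtoℚ-* z (pos (suc n)) ⟨
  ℤtoℚ (z ℤ.* pos (suc n))           ∎))) (ℤ.abs-* z (pos (suc n))))
  where
  open ≡-Reasoning
  leading : powerSumCoef n (suc n) ≡ recip n
  leading = begin
    recip n *ℚ (ι (suc n C suc n) *ℚ B (n ∸ n)) ≡⟨ cong₂ (λ s t → recip n *ℚ (ι s *ℚ B t)) (nCn≡1 (suc n)) (n∸n≡0 n) ⟩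
    recip n *ℚ (ι 1 *ℚ B 0)                     ≡⟨ cong (recip n *ℚ_) (cong₂ _*ℚ_ ι-1 (trans B-0 ι-1)) ⟩
    recip n *ℚ (1ℚ *ℚ 1ℚ)                       ≡⟨ ℚ.*-identityʳ (recip n) ⟩
    recip n                                     ∎

theorem3 : (n : ℕ) (c : Poly) (d : ℕ) (ε : ℕ → ℕ) →
    IsPowerSumPoly n c → IsLeastDenom c d → EpsSpec n ε →
    d ≡ suc n * primeProd (floorM n) (λ p → p ^ ε p)
theorem3 n c d ε isPSP (1≤d , ints , least) spec = ≤-antisym
    -- Minimality of d gives one inequality; the other holds because (n+1) Q divides d and d is
    -- positive.
    (least (suc n * Q) (*-mono-≤ (s≤s (z≤n {n})) (primeProd>0 (floorM n) ε)) (⇒integerCoeffs (ℕtoℚ (suc n * Q)) c clears))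
    (∣⇒≤ {{>-nonZero 1≤d}} (subst (suc n * Q ∣_) (trans (*-comm (suc n) q) (sym d≡q[1+n])) (*-monoʳ-∣ (suc n) (q∣ n ε spec q q-clears))))
  where
  Q : ℕ
  Q = primeProd (floorM n) (λ p → p ^ ε p)

  clears : ∀ i → IsInt (ℕtoℚ (suc n * Q) *ℚ coef c i)
  clears i = subst IsInt (sym (cong₂ _*ℚ_ (sym (ι≡ℕtoℚ (suc n * Q))) (coef≡powerSumCoef n c isPSP i))) (clears′ i)
    where
    clears′ : ∀ i → IsInt (ι (suc n * Q) *ℚ powerSumCoef n i)
    clears′ zero    = IsInt-*0 (ι (suc n * Q))
    clears′ (suc i) = [ below , above ]′ (≤-<-connex i n)
      where
      below : i ≤ n → IsInt (ι (suc n * Q) *ℚ powerSumCoef n (suc i))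
      below i≤n = subst IsInt (sym (trans (cong (λ t → ι t *ℚ powerSumCoef n (suc i)) (*-comm (suc n) Q)) ([1+n]q*coef n Q i i≤n)))
        (primeProd-clears n ε spec (n ∸ i) (m∸n≤m n i))
      above : n < i → IsInt (ι (suc n * Q) *ℚ powerSumCoef n (suc i))
      above n<i = subst (λ t → IsInt (ι (suc n * Q) *ℚ t)) (sym (powerSumCoef-high n (suc i) (s≤s n<i))) (IsInt-*0 (ι (suc n * Q)))

  ints′ : ∀ i → IsInt (ι d *ℚ powerSumCoef n i)
  ints′ i = subst IsInt (cong₂ _*ℚ_ (sym (ι≡ℕtoℚ d)) (coef≡powerSumCoef n c isPSP i)) (integerCoeffs⇒ (ℕtoℚ d) c ints i)

  1+n∣d : suc n ∣ d
  1+n∣d = leading⇒∣ n d (ints′ (suc n))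

  q : ℕ
  q = quotient 1+n∣d

  d≡q[1+n] : d ≡ q * suc n
  d≡q[1+n] = m∣n⇒n≡quotient*m 1+n∣d

  q-clears : ∀ k → k ≤ n → IsInt (ι q *ℚ (ι (suc n C k) *ℚ B k))
  q-clears k k≤n = subst (λ t → IsInt (ι q *ℚ (ι (suc n C t) *ℚ B t))) (m∸[m∸n]≡n k≤n)
    (subst IsInt (trans (cong (λ t → ι t *ℚ powerSumCoef n (suc (n ∸ k))) d≡q[1+n]) ([1+n]q*coef n q (n ∸ k) (m∸n≤m n k))) (ints′ (suc (n ∸ k))))
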